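{- As formal power series in $x$ and $t$, with $G(x)=\sum_{n\ge 0} n^n\frac{x^{n+1}}{(n+1)!}$, \begin{align*} 1+ \sum_{n\ge 0} \sum_{k=0}^n |\mathcal{T}_{n,k}| \frac{t^{k+1}}{k!} \frac{x^{n+1}}{(n+1)!} &= \exp\big( t\,G(x)\big),\\ 1+ \sum_{n\ge 0} \sum_{k=0}^n |\mathcal{T}_{n,k}| (k+1) t^{k+1} \frac{x^{n+1}}{(n+1)!} &= \big(1-t\,G(x)\big)^{ -1},\\ \sum_{n\ge 0} \sum_{k=0}^n |\mathcal{T}_{n,k}|\, t^{k+1} \frac{x^{n+1}}{(n+1)!} &= - \ln\big(1-t\,G(x)\big). \end{align*}
   Context: $\mathcal{T}_n$ is the set of rooted labeled trees on vertex set $[0,n]=\{0,\dots,n\}$. For $T\in\mathcal{T}_n$, the maximal decreasing subtree $\mathrm{MD}(T)$ is the subtree induced by the root and all vertices $v$ such that labels strictly decrease along the path from the root to $v$. $\mathcal{T}_{n,k}$ is the set of $T\in\mathcal{T}_n$ whose $\mathrm{MD}(T)$ has exactly $k+1$ vertices. Convention $0^0=1$. -}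

module Defs where

open import Data.Nat as ℕ using (ℕ; zero; suc; _∸_; _^_; _!)
open import Data.Nat.Properties as ℕP using ()
open import Data.Fin as F using (Fin; toℕ)
open import Data.Fin.Properties as FP using (any?; all?)
open import Data.Vec as V using (Vec; []; _∷_; lookup)
open import Data.List as L using (List; [_]; concatMap; length; filter)
open import Data.Integer using (+_)
open import Data.Rational as Q using (ℚ; 0ℚ; 1ℚ; _+_; _*_; _-_; _/_)
open import Data.Product using (_×_)
open import Relation.Nullary using (Dec; ¬_; yes; no)
open import Relation.Nullary.Decidable using (_×-dec_; _→-dec_; ¬?)
open import Relation.Binary.PropositionalEquality using (_≡_)

-- Rooted labelled trees on the vertex set [0,n] = Fin (suc n).
-- A tree is encoded by its parent map p : Vec (Fin (suc n)) (suc n),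
-- where the root is the unique vertex with p r = r.  Every vertex
-- reaches the root after n steps of p (depth ≤ n), so
-- root p = p^n(0), and p encodes a rooted tree iff
-- p(root) = root and p^n(v) = root for all v.
-- This gives a bijection between T_n and the parent maps satisfying IsTree.

ParentMap : ℕ → Set
ParentMap n = Vec (Fin (suc n)) (suc n)

iter : ∀ {m} → (Fin m → Fin m) → ℕ → Fin m → Fin m
iter f zero    v = v
iter f (suc i) v = f (iter f i v)

root : ∀ {n} → ParentMap n → Fin (suc n)
root {n} p = iter (lookup p) n F.zero

IsTree : ∀ {n} → ParentMap n → Set
IsTree {n} p = (lookup p (root p) ≡ root p) × (∀ v → iter (lookup p) n v ≡ root p)

isTree? : ∀ {n} (p : ParentMap n) → Dec (IsTree p)
isTree? {n} p = (lookup p (root p) F.≟ root p) ×-dec all? (λ v → iter (lookup p) n v F.≟ root p)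

-- v lies in the maximal decreasing subtree MD(T): along the path
-- root → … → v the labels strictly decrease, i.e. every non-root vertex w
-- on the path from v up to the root has label smaller than its parent's.
-- The vertices on that path other than the root are p^i(v), i < n, with p^i(v) ≠ root.
InMD : ∀ {n} → ParentMap n → Fin (suc n) → Set
InMD {n} p v = ∀ (i : Fin n) → ¬ (iter (lookup p) (toℕ i) v ≡ root p) →
  toℕ (iter (lookup p) (toℕ i) v) ℕ.< toℕ (lookup p (iter (lookup p) (toℕ i) v))

inMD? : ∀ {n} (p : ParentMap n) (v : Fin (suc n)) → Dec (InMD p v)
inMD? {n} p v = all? (λ i → ¬? (iter (lookup p) (toℕ i) v F.≟ root p) →-dec
  (toℕ (iter (lookup p) (toℕ i) v) ℕP.<? toℕ (lookup p (iter (lookup p) (toℕ i) v))))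

mdSize : ∀ {n} → ParentMap n → ℕ
mdSize {n} p = length (filter (inMD? p) (L.allFin (suc n)))

vecs : ∀ {A : Set} → List A → (m : ℕ) → List (Vec A m)
vecs xs zero    = [ [] ]
vecs xs (suc m) = concatMap (λ x → L.map (x ∷_) (vecs xs m)) xs

allParentMaps : (n : ℕ) → List (ParentMap n)
allParentMaps n = vecs (L.allFin (suc n)) (suc n)

countT : ℕ → ℕ → ℕ
countT n k = length (filter (λ p → isTree? p ×-dec (mdSize p ℕ.≟ suc k)) (allParentMaps n))

-- Bivariate formal power series over ℚ:  F i j = [x^i t^j] F.

Series : Set
Series = ℕ → ℕ → ℚ

fromℕ : ℕ → ℚ
fromℕ a = + a / 1

-- 1/d  (only used with d ≠ 0; recip 0 = 0 is a dummy value)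
recip : ℕ → ℚ
recip zero    = 0ℚ
recip (suc d) = + 1 / suc d

Σ≤ : ℕ → (ℕ → ℚ) → ℚ
Σ≤ zero    f = f 0
Σ≤ (suc m) f = Σ≤ m f + f (suc m)

oneS : Series
oneS zero zero = 1ℚ
oneS _    _    = 0ℚ

_-S_ : Series → Series → Series
(F -S H) i j = F i j - H i j

_*S_ : Series → Series → Series
(F *S H) i j = Σ≤ i (λ a → Σ≤ j (λ b → F a b * H (i ∸ a) (j ∸ b)))

powS : Series → ℕ → Series
powS F zero    = oneS
powS F (suc m) = F *S powS F m

-- For F with [x^0]F = 0, F^m has x-order ≥ m, so the following
-- finite sums are exactly the coefficients of the compositions
-- exp(F) = Σ_m F^m/m!  and  -ln(1-F) = Σ_{m≥1} F^m/m.
expS : Series → Series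
expS F i j = Σ≤ i (λ m → powS F m i j * recip (m !))

negLog1m : Series → Series
negLog1m F i j = Σ≤ i (λ m → powS F (suc m) i j * recip (suc m))

-- G(x) = Σ_{n≥0} n^n x^{n+1}/(n+1)!   (0^0 = 1)
G : Series
G (suc n) zero = fromℕ (n ^ n) * recip (suc n !)
G _       _    = 0ℚ

tG : Series
tG i zero    = 0ℚ
tG i (suc j) = G i j

inRange : ℕ → ℕ → ℚ → ℚ
inRange n k q with k ℕP.≤? n
... | yes _ = q
... | no  _ = 0ℚ

LHS₁ : Series
LHS₁ zero    zero    = 1ℚ
LHS₁ (suc n) (suc k) = inRange n k (fromℕ (countT n k) * recip (k !) * recip (suc n !))
LHS₁ _       _       = 0ℚ

LHS₂ : Series
LHS₂ zero    zero    = 1ℚ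
LHS₂ (suc n) (suc k) = inRange n k (fromℕ (countT n k) * fromℕ (suc k) * recip (suc n !))
LHS₂ _       _       = 0ℚ

LHS₃ : Series
LHS₃ (suc n) (suc k) = inRange n k (fromℕ (countT n k) * recip (suc n !))
LHS₃ _       _       = 0ℚ

{-# OPTIONS --safe #-}
module Submission where

-- Write G^j for the powers of G and ∇ for the backward difference.  All three identities say
-- (k+1) |T_{n,k}| = (n+1)! [x^{n+1}] G^{k+1}, and both sides equal ∇^{k+1} φ (n+1), where
-- φ(x) = x^{n+1} − (n+1) x^n.
--
-- Right-hand side: with T = x exp(T) one has G = 1 − exp(−T), and the coefficients of exp(aT)
-- are the values at N + a of x^N − N x^{N−1}, divided by N!; so multiplication by G is a
-- difference in a.  This is Abel's binomial identity.
--
-- Left-hand side: fix R = MD(T).  The condition on T splits into a condition on each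
-- parent and acyclicity outside R, so the matrix-tree theorem for a diagonal-minus-rank-one
-- Laplacian counts the trees as Π y − Σ_{v ∉ R} Π_{u ≠ v} y_u, where
-- y_v = n − k + #{r ∈ R, r < v} for v ∉ R.  Summing over R by scanning the vertices from the smallest produces the
-- Leibniz recurrence of ∇^{k+1} φ.

open import Defs
open import Data.Bool using (Bool; true; false; _∧_; _∨_; not; if_then_else_; T)
import Data.Bool.Properties as BP
open import Data.Empty using (⊥; ⊥-elim)
open import Data.Fin as F using (Fin; toℕ)
import Data.Fin.Properties as FP
import Data.Integer as ℤ
import Data.Integer.Properties as ℤP
open import Data.List as L using (List; []; _∷_; _++_; length; filter; concatMap; allFin)
import Data.List.Properties as LP
open import Data.Maybe as Maybe using (Maybe; just; nothing)
open import Data.Nat as ℕ using (ℕ; zero; suc; _∸_; z≤n; s≤s; _!)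
import Data.Nat.Coprimality as Coprimality
import Data.Nat.Properties as ℕP
open import Data.Product using (_×_; _,_; proj₁; proj₂; ∃)
open import Data.Rational using (ℚ; mkℚ; 0ℚ; 1ℚ; _+_; _*_; _-_; -_; 1/_; _/_)
import Data.Rational.Properties as ℚP
open ℚP using (*-zeroˡ; *-zeroʳ; *-identityˡ; *-identityʳ; +-identityˡ; +-identityʳ)
open import Data.Sum using (_⊎_; inj₁; inj₂)
open import Data.Unit using (tt)
open import Data.Vec as V using (Vec; []; _∷_; lookup)
import Data.Vec.Properties as VP
open import Function using (_∘_; id)
open import Function.Bundles using (Equivalence)
open import Level using (0ℓ)
open import Relation.Binary.Definitions using (tri<; tri≈; tri>)
open import Relation.Binary.PropositionalEquality
open import Relation.Nullary using (Dec; yes; no; does)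
open import Relation.Nullary.Decidable using (dec-true; dec⇒maybe; _×-dec_)
open import Relation.Nullary.Negation using (contradiction)
open import Tactic.RingSolver using (solve-∀)
open import Tactic.RingSolver.Core.AlmostCommutativeRing using (AlmostCommutativeRing; fromCommutativeRing)

open ≡-Reasoning

-- The coefficient of x^N in exp(aT) is a (N+a)^(N-1) / N!. Writing a as (N+a) - N turns it into a
-- difference of two divided powers with the common base N+a, and Abel's identity applies to each of
-- them; so the series T is never constructed and no Lagrange inversion is needed. At a = 0 this is
-- the coefficient of the series 1, the starting point for the powers of G, and the substitution x =
-- N + a moves a = 0 to x = N.
--
-- On the tree side the elements of R have k! joint choices of parents, whatever R is: the largest
-- is the root, and an element with r > 0 elements of R above it has r possible parents. The factor
-- k+1 completes this to (k+1)!, the ratio of a (k+1)-st difference with unit steps to the divided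
-- difference at the same nodes. These nodes are n-k, ..., n+1, the values that y_v can take for v ∉
-- R. The sum subtracted in the tree count is the derivative of the product under a common
-- translation of all y_v with v ∉ R, which is why φ is a power minus its derivative.

private variable
  A B : Set

-- Rational arithmetic: embedded naturals, reciprocals, powers

ringℚ : AlmostCommutativeRing 0ℓ 0ℓ
ringℚ = fromCommutativeRing ℚP.+-*-commutativeRing (λ x → dec⇒maybe (0ℚ ℚP.≟ x))

+-interchange : ∀ a b c d → a + b + (c + d) ≡ a + c + (b + d)
+-interchange = solve-∀ ringℚ

+-−-interchange : ∀ a b c d → a - b + (c - d) ≡ a + c - (b + d)
+-−-interchange = solve-∀ ringℚ

*-swap : ∀ a b c → a * (b * c) ≡ b * (a * c)
*-swap = solve-∀ ringℚ

*-distribˡ-− : ∀ a b c → a * (b - c) ≡ a * b - a * c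
*-distribˡ-− = solve-∀ ringℚ

-- For a variable a, `+ a / 1` is stuck on a gcd; the explicit fraction with denominator 1 lets sums
-- and products compute.
fromℕ-normal : ∀ a → fromℕ a ≡ mkℚ (ℤ.+ a) 0 (Coprimality.sym (Coprimality.1-coprimeTo a))
fromℕ-normal a = ℚP.normalize-coprime {a} {0} (Coprimality.sym (Coprimality.1-coprimeTo a))

fromℕ-+ : ∀ a b → fromℕ (a ℕ.+ b) ≡ fromℕ a + fromℕ b
fromℕ-+ a b = begin
  ℤ.+ (a ℕ.+ b) / 1                        ≡⟨ ℚP./-cong {ℤ.+ (a ℕ.+ b)} {1} (sym (cong₂ ℤ._+_ (ℤP.*-identityʳ (ℤ.+ a)) (ℤP.*-identityʳ (ℤ.+ b)))) refl ⟩
  (ℤ.+ a ℤ.* ℤ.+ 1 ℤ.+ ℤ.+ b ℤ.* ℤ.+ 1) / 1      ≡⟨ sym (cong₂ _+_ (fromℕ-normal a) (fromℕ-normal b)) ⟩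
  fromℕ a + fromℕ b                      ∎

fromℕ-* : ∀ a b → fromℕ (a ℕ.* b) ≡ fromℕ a * fromℕ b
fromℕ-* a b = begin
  ℤ.+ (a ℕ.* b) / 1          ≡⟨ ℚP./-cong {ℤ.+ (a ℕ.* b)} {1} (ℤP.pos-* a b) refl ⟩
  (ℤ.+ a ℤ.* ℤ.+ b) / 1        ≡⟨ sym (cong₂ _*_ (fromℕ-normal a) (fromℕ-normal b)) ⟩
  fromℕ a * fromℕ b        ∎

fromℕ-suc : ∀ a → fromℕ (suc a) ≡ 1ℚ + fromℕ a
fromℕ-suc a = fromℕ-+ 1 a

recip-inverseˡ : ∀ d .{{_ : ℕ.NonZero d}} → recip d * fromℕ d ≡ 1ℚ
recip-inverseˡ (suc d) = begin
  recip (suc d) * fromℕ (suc d)  ≡⟨ cong₂ _*_ (ℚP.normalize-coprime {1} {d} (Coprimality.1-coprimeTo (suc d))) (fromℕ-normal (suc d)) ⟩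
  1/ q * q                       ≡⟨ ℚP.*-inverseˡ q ⟩
  1ℚ                             ∎
  where
  q : ℚ
  q = mkℚ (ℤ.+ suc d) 0 (Coprimality.sym (Coprimality.1-coprimeTo (suc d)))

fromℕ-cancel : ∀ d .{{_ : ℕ.NonZero d}} {x y} → fromℕ d * x ≡ fromℕ d * y → x ≡ y
fromℕ-cancel d {x} {y} eq = begin
  x                          ≡⟨ expand x ⟩
  recip d * (fromℕ d * x)    ≡⟨ cong (recip d *_) eq ⟩
  recip d * (fromℕ d * y)    ≡⟨ sym (expand y) ⟩
  y                          ∎
  where
  expand : ∀ z → z ≡ recip d * (fromℕ d * z)
  expand z = begin
    z                        ≡⟨ sym (*-identityˡ z) ⟩
    1ℚ * z                   ≡⟨ cong (_* z) (sym (recip-inverseˡ d)) ⟩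
    recip d * fromℕ d * z    ≡⟨ ℚP.*-assoc (recip d) (fromℕ d) z ⟩
    recip d * (fromℕ d * z)  ∎

recip-* : ∀ a b .{{_ : ℕ.NonZero a}} .{{_ : ℕ.NonZero b}} → recip (a ℕ.* b) ≡ recip a * recip b
recip-* a@(suc _) b@(suc _) = fromℕ-cancel (a ℕ.* b) (begin
  fromℕ (a ℕ.* b) * recip (a ℕ.* b)              ≡⟨ ℚP.*-comm (fromℕ (a ℕ.* b)) _ ⟩
  recip (a ℕ.* b) * fromℕ (a ℕ.* b)              ≡⟨ recip-inverseˡ (a ℕ.* b) ⟩
  1ℚ                                             ≡⟨⟩
  1ℚ * 1ℚ                                        ≡⟨ sym (cong₂ _*_ (recip-inverseˡ a) (recip-inverseˡ b)) ⟩
  recip a * fromℕ a * (recip b * fromℕ b)        ≡⟨ rearrange (recip a) (fromℕ a) (recip b) (fromℕ b) ⟩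
  fromℕ a * fromℕ b * (recip a * recip b)        ≡⟨ cong (_* (recip a * recip b)) (sym (fromℕ-* a b)) ⟩
  fromℕ (a ℕ.* b) * (recip a * recip b)          ∎)
  where
  rearrange : ∀ p q r s → p * q * (r * s) ≡ q * s * (p * r)
  rearrange = solve-∀ ringℚ

infixr 8 _↑_
_↑_ : ℚ → ℕ → ℚ
x ↑ zero  = 1ℚ
x ↑ suc n = x * x ↑ n

fromℕ-^ : ∀ a n → fromℕ (a ℕ.^ n) ≡ fromℕ a ↑ n
fromℕ-^ a zero    = refl
fromℕ-^ a (suc n) = trans (fromℕ-* a (a ℕ.^ n)) (cong (fromℕ a *_) (fromℕ-^ a n))

↑-+ : ∀ x m n → x ↑ (m ℕ.+ n) ≡ x ↑ m * x ↑ n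
↑-+ x zero    n = sym (*-identityˡ _)
↑-+ x (suc m) n = trans (cong (x *_) (↑-+ x m n)) (sym (ℚP.*-assoc x _ _))

⟦_⟧ : Bool → ℚ
⟦ true ⟧  = 1ℚ
⟦ false ⟧ = 0ℚ

⟦⟧-∧ : ∀ a b → ⟦ a ∧ b ⟧ ≡ ⟦ a ⟧ * ⟦ b ⟧
⟦⟧-∧ true  b = sym (*-identityˡ ⟦ b ⟧)
⟦⟧-∧ false b = sym (*-zeroˡ ⟦ b ⟧)

-- Finite sums over lists

∑ : List A → (A → ℚ) → ℚ
∑ []       f = 0ℚ
∑ (x ∷ xs) f = f x + ∑ xs f

∑-cong : ∀ (xs : List A) {f g} → (∀ x → f x ≡ g x) → ∑ xs f ≡ ∑ xs g
∑-cong []       eq = refl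
∑-cong (x ∷ xs) eq = cong₂ _+_ (eq x) (∑-cong xs eq)

∑-+ : ∀ (xs : List A) f g → ∑ xs (λ x → f x + g x) ≡ ∑ xs f + ∑ xs g
∑-+ []       f g = refl
∑-+ (x ∷ xs) f g = trans (cong (λ t → f x + g x + t) (∑-+ xs f g)) (+-interchange (f x) (g x) (∑ xs f) (∑ xs g))

∑-*ˡ : ∀ (xs : List A) c f → ∑ xs (λ x → c * f x) ≡ c * ∑ xs f
∑-*ˡ []       c f = sym (*-zeroʳ c)
∑-*ˡ (x ∷ xs) c f = trans (cong (λ t → c * f x + t) (∑-*ˡ xs c f)) (sym (ℚP.*-distribˡ-+ c (f x) (∑ xs f)))

∑-*ʳ : ∀ (xs : List A) c f → ∑ xs (λ x → f x * c) ≡ ∑ xs f * c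
∑-*ʳ xs c f = trans (∑-cong xs (λ x → ℚP.*-comm (f x) c)) (trans (∑-*ˡ xs c f) (ℚP.*-comm c _))

∑-zero : ∀ (xs : List A) → ∑ xs (λ _ → 0ℚ) ≡ 0ℚ
∑-zero []       = refl
∑-zero (x ∷ xs) = cong (0ℚ +_) (∑-zero xs)

∑-− : ∀ (xs : List A) f g → ∑ xs (λ x → f x - g x) ≡ ∑ xs f - ∑ xs g
∑-− []       f g = refl
∑-− (x ∷ xs) f g = trans (cong (λ t → f x - g x + t) (∑-− xs f g)) (+-−-interchange (f x) (g x) (∑ xs f) (∑ xs g))

∑-++ : ∀ (xs ys : List A) f → ∑ (xs ++ ys) f ≡ ∑ xs f + ∑ ys f
∑-++ []       ys f = sym (+-identityˡ _)
∑-++ (x ∷ xs) ys f = trans (cong (f x +_) (∑-++ xs ys f)) (sym (ℚP.+-assoc (f x) _ _))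

∑-swap : ∀ (xs : List A) (ys : List B) (f : A → B → ℚ) →
         ∑ xs (λ x → ∑ ys (f x)) ≡ ∑ ys (λ y → ∑ xs (λ x → f x y))
∑-swap []       ys f = sym (∑-zero ys)
∑-swap (x ∷ xs) ys f = trans (cong (∑ ys (f x) +_) (∑-swap xs ys f)) (sym (∑-+ ys (f x) (λ y → ∑ xs (λ x → f x y))))

∑-map : ∀ (h : B → A) (xs : List B) f → ∑ (L.map h xs) f ≡ ∑ xs (f ∘ h)
∑-map h []       f = refl
∑-map h (x ∷ xs) f = cong (f (h x) +_) (∑-map h xs f)

∑-concatMap : ∀ (h : B → List A) (xs : List B) f → ∑ (concatMap h xs) f ≡ ∑ xs (λ x → ∑ (h x) f)
∑-concatMap h []       f = refl
∑-concatMap h (x ∷ xs) f = trans (∑-++ (h x) _ f) (cong (∑ (h x) f +_) (∑-concatMap h xs f))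

count-∑ : ∀ {P : A → Set} (P? : ∀ x → Dec (P x)) (xs : List A) →
          fromℕ (length (filter P? xs)) ≡ ∑ xs (λ x → ⟦ does (P? x) ⟧)
count-∑ P? []       = refl
count-∑ P? (x ∷ xs) with does (P? x)
... | true  = trans (fromℕ-suc (length (filter P? xs))) (cong (1ℚ +_) (count-∑ P? xs))
... | false = trans (count-∑ P? xs) (sym (+-identityˡ _))

∑-vecs : ∀ (xs : List A) m (f : Vec A (suc m) → ℚ) →
         ∑ (vecs xs (suc m)) f ≡ ∑ xs (λ x → ∑ (vecs xs m) (λ v → f (x ∷ v)))
∑-vecs xs m f = trans (∑-concatMap (λ x → L.map (x ∷_) (vecs xs m)) xs f)
                      (∑-cong xs (λ x → ∑-map (x ∷_) (vecs xs m) f))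

∑-allFin : ∀ m (f : Fin (suc m) → ℚ) → ∑ (allFin (suc m)) f ≡ f F.zero + ∑ (allFin m) (f ∘ F.suc)
∑-allFin m f = cong (f F.zero +_) (trans (cong (λ l → ∑ l f) (sym (LP.map-tabulate id F.suc))) (∑-map F.suc (allFin m) f))

-- Sums over initial segments of the naturals

Σ≤-cong : ∀ n {f g} → (∀ i → i ℕ.≤ n → f i ≡ g i) → Σ≤ n f ≡ Σ≤ n g
Σ≤-cong zero    eq = eq 0 z≤n
Σ≤-cong (suc n) eq = cong₂ _+_ (Σ≤-cong n (λ i i≤n → eq i (ℕP.m≤n⇒m≤1+n i≤n))) (eq (suc n) ℕP.≤-refl)

Σ≤-+ : ∀ n f g → Σ≤ n (λ i → f i + g i) ≡ Σ≤ n f + Σ≤ n g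
Σ≤-+ zero    f g = refl
Σ≤-+ (suc n) f g = trans (cong (_+ (f (suc n) + g (suc n))) (Σ≤-+ n f g)) (+-interchange (Σ≤ n f) (Σ≤ n g) (f (suc n)) (g (suc n)))

Σ≤-*ˡ : ∀ n c f → Σ≤ n (λ i → c * f i) ≡ c * Σ≤ n f
Σ≤-*ˡ zero    c f = refl
Σ≤-*ˡ (suc n) c f = trans (cong (_+ c * f (suc n)) (Σ≤-*ˡ n c f)) (sym (ℚP.*-distribˡ-+ c (Σ≤ n f) (f (suc n))))

Σ≤-− : ∀ n f g → Σ≤ n (λ i → f i - g i) ≡ Σ≤ n f - Σ≤ n g
Σ≤-− zero    f g = refl
Σ≤-− (suc n) f g = trans (cong (_+ (f (suc n) - g (suc n))) (Σ≤-− n f g)) (+-−-interchange (Σ≤ n f) (Σ≤ n g) (f (suc n)) (g (suc n)))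

Σ≤-zero : ∀ n {f} → (∀ i → i ℕ.≤ n → f i ≡ 0ℚ) → Σ≤ n f ≡ 0ℚ
Σ≤-zero zero    eq = eq 0 z≤n
Σ≤-zero (suc n) eq = cong₂ _+_ (Σ≤-zero n (λ i i≤n → eq i (ℕP.m≤n⇒m≤1+n i≤n))) (eq (suc n) ℕP.≤-refl)

Σ≤-last : ∀ n {f} → (∀ i → i ℕ.< n → f i ≡ 0ℚ) → Σ≤ n f ≡ f n
Σ≤-last zero    eq = refl
Σ≤-last (suc n) {f} eq = trans (cong (_+ f (suc n)) (Σ≤-zero n (λ i i≤n → eq i (s≤s i≤n)))) (+-identityˡ _)

Σ≤-head : ∀ n f → Σ≤ (suc n) f ≡ f 0 + Σ≤ n (f ∘ suc)
Σ≤-head zero    f = refl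
Σ≤-head (suc n) f = trans (cong (_+ f (suc (suc n))) (Σ≤-head n f)) (ℚP.+-assoc (f 0) _ _)

Σ≤-first : ∀ n {f} → (∀ i → f (suc i) ≡ 0ℚ) → Σ≤ n f ≡ f 0
Σ≤-first zero    eq = refl
Σ≤-first (suc n) {f} eq = trans (cong₂ _+_ (Σ≤-first n eq) (eq n)) (+-identityʳ (f 0))

Σ≤-triangle : ∀ n (f : ℕ → ℕ → ℚ) →
              Σ≤ n (λ i → Σ≤ (n ∸ i) (f i)) ≡ Σ≤ n (λ j → Σ≤ (n ∸ j) (λ i → f i j))
Σ≤-triangle zero    f = refl
Σ≤-triangle (suc n) f = begin
  Σ≤ n (λ i → Σ≤ (suc n ∸ i) (f i)) + Σ≤ (n ∸ n) (f (suc n))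
    ≡⟨ cong₂ _+_ (trans (Σ≤-cong n row) (Σ≤-+ n (λ i → f i 0) _)) (cong (λ d → Σ≤ d (f (suc n))) (ℕP.n∸n≡0 n)) ⟩
  Σ≤ n (λ i → f i 0) + Σ≤ n (λ i → Σ≤ (n ∸ i) (f i ∘ suc)) + f (suc n) 0
    ≡⟨ rearrange (Σ≤ n (λ i → f i 0)) _ (f (suc n) 0) ⟩
  Σ≤ (suc n) (λ i → f i 0) + Σ≤ n (λ i → Σ≤ (n ∸ i) (f i ∘ suc))
    ≡⟨ cong (Σ≤ (suc n) (λ i → f i 0) +_) (Σ≤-triangle n (λ i → f i ∘ suc)) ⟩
  Σ≤ (suc n) (λ i → f i 0) + Σ≤ n (λ j → Σ≤ (n ∸ j) (λ i → f i (suc j)))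
    ≡⟨ sym (Σ≤-head n (λ j → Σ≤ (suc n ∸ j) (λ i → f i j))) ⟩
  Σ≤ (suc n) (λ j → Σ≤ (suc n ∸ j) (λ i → f i j)) ∎
  where
  rearrange : ∀ a b c → a + b + c ≡ a + c + b
  rearrange = solve-∀ ringℚ
  row : ∀ i → i ℕ.≤ n → Σ≤ (suc n ∸ i) (f i) ≡ f i 0 + Σ≤ (n ∸ i) (f i ∘ suc)
  row i i≤n = trans (cong (λ d → Σ≤ d (f i)) (ℕP.+-∸-assoc 1 i≤n)) (Σ≤-head (n ∸ i) (f i))

fromℕ-∸ : ∀ {m n} → n ℕ.≤ m → fromℕ (m ∸ n) ≡ fromℕ m - fromℕ n
fromℕ-∸ {m} {n} n≤m = begin
  fromℕ (m ∸ n)                          ≡⟨ add-sub (fromℕ (m ∸ n)) (fromℕ n) ⟩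
  fromℕ (m ∸ n) + fromℕ n - fromℕ n      ≡⟨ cong (_- fromℕ n) (sym (fromℕ-+ (m ∸ n) n)) ⟩
  fromℕ (m ∸ n ℕ.+ n) - fromℕ n          ≡⟨ cong (λ t → fromℕ t - fromℕ n) (ℕP.m∸n+n≡m n≤m) ⟩
  fromℕ m - fromℕ n                      ∎
  where
  add-sub : ∀ a b → a ≡ a + b - b
  add-sub = solve-∀ ringℚ

-- Divided powers

dp : ℚ → ℕ → ℚ
dp x n = x ↑ n * recip (n !)

recip-! : ∀ n → fromℕ (suc n) * recip (suc n !) ≡ recip (n !)
recip-! n = begin
  fromℕ (suc n) * recip (suc n !)                  ≡⟨ cong (fromℕ (suc n) *_) (recip-* (suc n) (n !) {{_}} {{n ℕP.!≢0}}) ⟩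
  fromℕ (suc n) * (recip (suc n) * recip (n !))    ≡⟨ rearrange (fromℕ (suc n)) (recip (suc n)) (recip (n !)) ⟩
  recip (suc n) * fromℕ (suc n) * recip (n !)      ≡⟨ cong (_* recip (n !)) (recip-inverseˡ (suc n)) ⟩
  1ℚ * recip (n !)                                 ≡⟨ *-identityˡ _ ⟩
  recip (n !)                                      ∎
  where
  rearrange : ∀ a b c → a * (b * c) ≡ b * a * c
  rearrange = solve-∀ ringℚ

dp-suc : ∀ x n → fromℕ (suc n) * dp x (suc n) ≡ x * dp x n
dp-suc x n = trans (rearrange (fromℕ (suc n)) x (x ↑ n) (recip (suc n !))) (cong (λ t → x * (x ↑ n * t)) (recip-! n))
  where
  rearrange : ∀ a b c d → a * (b * c * d) ≡ b * (c * (a * d))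
  rearrange = solve-∀ ringℚ

-- Binomial theorem. In each term the factor n+1 is split as j + (n+1 - j), and each half lowers one
-- of the two divided powers, as in the product rule for derivatives.
dp-+ : ∀ x y n → dp (x + y) n ≡ Σ≤ n (λ j → dp x j * dp y (n ∸ j))
dp-+ x y zero    = refl
dp-+ x y (suc n) = fromℕ-cancel (suc n) (begin
  fromℕ (suc n) * dp (x + y) (suc n)                          ≡⟨ dp-suc (x + y) n ⟩
  (x + y) * dp (x + y) n                                      ≡⟨ cong ((x + y) *_) (dp-+ x y n) ⟩
  (x + y) * Σ≤ n t                                            ≡⟨ ℚP.*-distribʳ-+ (Σ≤ n t) x y ⟩
  x * Σ≤ n t + y * Σ≤ n t                                     ≡⟨ sym (cong₂ _+_ left right) ⟩
  Σ≤ (suc n) (λ j → fromℕ j * u j) + Σ≤ (suc n) (λ j → fromℕ (suc n ∸ j) * u j)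
                                                              ≡⟨ sym (Σ≤-+ (suc n) (λ j → fromℕ j * u j) _) ⟩
  Σ≤ (suc n) (λ j → fromℕ j * u j + fromℕ (suc n ∸ j) * u j)  ≡⟨ Σ≤-cong (suc n) split ⟩
  Σ≤ (suc n) (λ j → fromℕ (suc n) * u j)                      ≡⟨ Σ≤-*ˡ (suc n) (fromℕ (suc n)) u ⟩
  fromℕ (suc n) * Σ≤ (suc n) u                                ∎)
  where
  t u : ℕ → ℚ
  t j = dp x j * dp y (n ∸ j)
  u j = dp x j * dp y (suc n ∸ j)
  assoc-suc : ∀ a b c d e → a * b ≡ c * d → a * (b * e) ≡ c * (d * e)
  assoc-suc a b c d e eq = trans (sym (ℚP.*-assoc a b e)) (trans (cong (_* e) eq) (ℚP.*-assoc c d e))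
  left : Σ≤ (suc n) (λ j → fromℕ j * u j) ≡ x * Σ≤ n t
  left = begin
    Σ≤ (suc n) (λ j → fromℕ j * u j)                             ≡⟨ Σ≤-head n (λ j → fromℕ j * u j) ⟩
    0ℚ * u 0 + Σ≤ n (λ j → fromℕ (suc j) * u (suc j))            ≡⟨ cong₂ _+_ (*-zeroˡ (u 0)) (Σ≤-cong n (λ j _ → assoc-suc (fromℕ (suc j)) (dp x (suc j)) x (dp x j) (dp y (n ∸ j)) (dp-suc x j))) ⟩
    0ℚ + Σ≤ n (λ j → x * t j)                                    ≡⟨ +-identityˡ _ ⟩
    Σ≤ n (λ j → x * t j)                                         ≡⟨ Σ≤-*ˡ n x t ⟩
    x * Σ≤ n t                                                   ∎
  right-term : ∀ j → j ℕ.≤ n → fromℕ (suc n ∸ j) * u j ≡ y * t j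
  right-term j j≤n = begin
    fromℕ (suc n ∸ j) * (dp x j * dp y (suc n ∸ j))              ≡⟨ cong (λ d → fromℕ d * (dp x j * dp y d)) (ℕP.+-∸-assoc 1 j≤n) ⟩
    fromℕ (suc (n ∸ j)) * (dp x j * dp y (suc (n ∸ j)))          ≡⟨ *-swap (fromℕ (suc (n ∸ j))) (dp x j) (dp y (suc (n ∸ j))) ⟩
    dp x j * (fromℕ (suc (n ∸ j)) * dp y (suc (n ∸ j)))          ≡⟨ cong (dp x j *_) (dp-suc y (n ∸ j)) ⟩
    dp x j * (y * dp y (n ∸ j))                                  ≡⟨ *-swap (dp x j) y _ ⟩
    y * t j                                                      ∎
  right : Σ≤ (suc n) (λ j → fromℕ (suc n ∸ j) * u j) ≡ y * Σ≤ n t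
  right = begin
    Σ≤ n (λ j → fromℕ (suc n ∸ j) * u j) + fromℕ (n ∸ n) * u (suc n)
      ≡⟨ cong₂ _+_ (trans (Σ≤-cong n right-term) (Σ≤-*ˡ n y t)) (trans (cong (λ d → fromℕ d * u (suc n)) (ℕP.n∸n≡0 n)) (*-zeroˡ (u (suc n)))) ⟩
    y * Σ≤ n t + 0ℚ                                              ≡⟨ +-identityʳ _ ⟩
    y * Σ≤ n t                                                   ∎
  split : ∀ j → j ℕ.≤ suc n → fromℕ j * u j + fromℕ (suc n ∸ j) * u j ≡ fromℕ (suc n) * u j
  split j j≤ = begin
    fromℕ j * u j + fromℕ (suc n ∸ j) * u j    ≡⟨ sym (ℚP.*-distribʳ-+ (u j) (fromℕ j) _) ⟩
    (fromℕ j + fromℕ (suc n ∸ j)) * u j        ≡⟨ cong (_* u j) (trans (sym (fromℕ-+ j (suc n ∸ j))) (cong fromℕ (ℕP.m+[n∸m]≡n j≤))) ⟩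
    fromℕ (suc n) * u j                        ∎

1↑ : ∀ n → 1ℚ ↑ n ≡ 1ℚ
1↑ zero    = refl
1↑ (suc n) = trans (*-identityˡ _) (1↑ n)

dp-0 : ∀ n → dp 0ℚ (suc n) ≡ 0ℚ
dp-0 n = trans (cong (_* recip (suc n !)) (*-zeroˡ (0ℚ ↑ n))) (*-zeroˡ (recip (suc n !)))

-- The M-th finite difference of the d-th power, divided by M!.
diff : ℕ → ℚ → ℕ → ℚ
diff M x d = Σ≤ M (λ i → dp (- 1ℚ) i * ((x - fromℕ i) ↑ d * recip ((M ∸ i) !)))

-- One factor x - i of the power is split: x leaves the sum, while i cancels against the factorial
-- in `dp (- 1ℚ) i`, which shifts the summation by one and moves x to x - 1.
diff-suc : ∀ M x d → diff (suc M) x (suc d) ≡ x * diff (suc M) x d + diff M (x - 1ℚ) d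
diff-suc M x d = begin
  Σ≤ (suc M) (λ i → s i * ((x - fromℕ i) * p i * r i))        ≡⟨ Σ≤-cong (suc M) (λ i _ → expand (s i) x (fromℕ i) (p i) (r i)) ⟩
  Σ≤ (suc M) (λ i → x * (s i * (p i * r i)) - fromℕ i * (s i * (p i * r i)))
                                                              ≡⟨ Σ≤-− (suc M) (λ i → x * (s i * (p i * r i))) _ ⟩
  Σ≤ (suc M) (λ i → x * (s i * (p i * r i))) - Σ≤ (suc M) (λ i → fromℕ i * (s i * (p i * r i)))
                                                              ≡⟨ cong₂ _-_ (Σ≤-*ˡ (suc M) x _) lower ⟩
  x * diff (suc M) x d - (- 1ℚ) * diff M (x - 1ℚ) d           ≡⟨ minus-minus (x * diff (suc M) x d) (diff M (x - 1ℚ) d) ⟩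
  x * diff (suc M) x d + diff M (x - 1ℚ) d                    ∎
  where
  s p r : ℕ → ℚ
  s i = dp (- 1ℚ) i
  p i = (x - fromℕ i) ↑ d
  r i = recip ((suc M ∸ i) !)
  expand : ∀ s x i p r → s * ((x - i) * p * r) ≡ x * (s * (p * r)) - i * (s * (p * r))
  expand = solve-∀ ringℚ
  minus-minus : ∀ a b → a - (- 1ℚ) * b ≡ a + b
  minus-minus = solve-∀ ringℚ
  shift : ∀ x i → x - (1ℚ + i) ≡ x - 1ℚ - i
  shift = solve-∀ ringℚ
  lower : Σ≤ (suc M) (λ i → fromℕ i * (s i * (p i * r i))) ≡ (- 1ℚ) * diff M (x - 1ℚ) d
  lower = begin
    Σ≤ (suc M) (λ i → fromℕ i * (s i * (p i * r i)))
      ≡⟨ Σ≤-head M (λ i → fromℕ i * (s i * (p i * r i))) ⟩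
    0ℚ * (s 0 * (p 0 * r 0)) + Σ≤ M (λ i → fromℕ (suc i) * (s (suc i) * (p (suc i) * r (suc i))))
      ≡⟨ cong₂ _+_ (*-zeroˡ (s 0 * (p 0 * r 0))) (Σ≤-cong M (λ i _ → term i)) ⟩
    0ℚ + Σ≤ M (λ i → (- 1ℚ) * (dp (- 1ℚ) i * ((x - 1ℚ - fromℕ i) ↑ d * recip ((M ∸ i) !))))
      ≡⟨ trans (+-identityˡ _) (Σ≤-*ˡ M (- 1ℚ) _) ⟩
    (- 1ℚ) * diff M (x - 1ℚ) d ∎
    where
    term : ∀ i → fromℕ (suc i) * (s (suc i) * (p (suc i) * r (suc i)))
               ≡ (- 1ℚ) * (dp (- 1ℚ) i * ((x - 1ℚ - fromℕ i) ↑ d * recip ((M ∸ i) !)))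
    term i = begin
      fromℕ (suc i) * (s (suc i) * (p (suc i) * r (suc i)))   ≡⟨ sym (ℚP.*-assoc (fromℕ (suc i)) (s (suc i)) _) ⟩
      fromℕ (suc i) * s (suc i) * (p (suc i) * r (suc i))     ≡⟨ cong₂ (λ a b → a * (b ↑ d * r (suc i))) (dp-suc (- 1ℚ) i) (trans (cong (λ t → x - t) (fromℕ-suc i)) (shift x (fromℕ i))) ⟩
      (- 1ℚ) * s i * ((x - 1ℚ - fromℕ i) ↑ d * r (suc i))     ≡⟨ ℚP.*-assoc (- 1ℚ) (s i) _ ⟩
      (- 1ℚ) * (s i * ((x - 1ℚ - fromℕ i) ↑ d * r (suc i)))   ∎

-- Differences of order M kill polynomials of degree below M; for degree 0 this is (-1 + 1)^M = 0 by
-- the binomial theorem.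
diff-vanishes : ∀ M x d → d ℕ.< M → diff M x d ≡ 0ℚ
diff-vanishes (suc M) x zero    _           = begin
  Σ≤ (suc M) (λ i → dp (- 1ℚ) i * (1ℚ * recip ((suc M ∸ i) !)))     ≡⟨ Σ≤-cong (suc M) (λ i _ → cong (λ t → dp (- 1ℚ) i * (t * recip ((suc M ∸ i) !))) (sym (1↑ (suc M ∸ i)))) ⟩
  Σ≤ (suc M) (λ i → dp (- 1ℚ) i * dp 1ℚ (suc M ∸ i))                ≡⟨ sym (dp-+ (- 1ℚ) 1ℚ (suc M)) ⟩
  dp (- 1ℚ + 1ℚ) (suc M)                                            ≡⟨ dp-0 M ⟩
  0ℚ                                                                ∎
diff-vanishes (suc M) x (suc d) (s≤s d<M) = begin
  diff (suc M) x (suc d)                       ≡⟨ diff-suc M x d ⟩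
  x * diff (suc M) x d + diff M (x - 1ℚ) d     ≡⟨ cong₂ (λ a b → x * a + b) (diff-vanishes (suc M) x d (ℕP.m<n⇒m<1+n d<M)) (diff-vanishes M (x - 1ℚ) d d<M) ⟩
  x * 0ℚ + 0ℚ                                  ≡⟨ trans (+-identityʳ _) (*-zeroʳ x) ⟩
  0ℚ                                           ∎

-- Abel's identity and the powers of G

open ≡-Reasoning

egf-G : ℕ → ℚ
egf-G i = G i 0

-- The coefficients of 1 - G, which plays the role of exp(-T).
cG : ℕ → ℚ
cG i = oneS i 0 - egf-G i

neg↑ : ∀ x n → (- 1ℚ) ↑ n * (- x) ↑ n ≡ x ↑ n
neg↑ x zero    = refl
neg↑ x (suc n) = trans (rearrange x ((- 1ℚ) ↑ n) ((- x) ↑ n)) (cong (x *_) (neg↑ x n))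
  where
  rearrange : ∀ x a b → (- 1ℚ) * a * ((- x) * b) ≡ x * (a * b)
  rearrange = solve-∀ ringℚ

-- The coefficient of 1 - G at i+1 is -i^i / (i+1)!, and 1 - (i+1) = -i. So the two powers merge
-- into one whose exponent m no longer depends on i, and the terms become those of `diff`.
cG-dp : ∀ m i → i ℕ.≤ suc m →
        cG i * dp (1ℚ - fromℕ i) (suc m ∸ i) ≡ dp (- 1ℚ) i * ((1ℚ - fromℕ i) ↑ m * recip ((suc m ∸ i) !))
-- At i = 0 the base is 1, so the exponent m+1 may be replaced by m.
cG-dp m zero    _         = cong (λ t → 1ℚ * (t * recip (suc m !))) (*-identityˡ ((1ℚ - 0ℚ) ↑ m))
cG-dp m (suc i) (s≤s i≤m) = begin
  (0ℚ - fromℕ (i ℕ.^ i) * r) * (y ↑ (m ∸ i) * r′)                        ≡⟨ cong (λ t → (0ℚ - t * r) * (y ↑ (m ∸ i) * r′)) (trans (fromℕ-^ i i) (sym power)) ⟩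
  (0ℚ - (- 1ℚ) ↑ i * y ↑ i * r) * (y ↑ (m ∸ i) * r′)                     ≡⟨ rearrange ((- 1ℚ) ↑ i) (y ↑ i) r (y ↑ (m ∸ i)) r′ ⟩
  (- 1ℚ) * (- 1ℚ) ↑ i * r * (y ↑ i * y ↑ (m ∸ i) * r′)                   ≡⟨ cong (λ t → (- 1ℚ) * (- 1ℚ) ↑ i * r * (t * r′)) (trans (sym (↑-+ y i (m ∸ i))) (cong (y ↑_) (ℕP.m+[n∸m]≡n i≤m))) ⟩
  (- 1ℚ) * (- 1ℚ) ↑ i * r * (y ↑ m * r′)                                 ∎
  where
  r r′ y : ℚ
  r  = recip (suc i !)
  r′ = recip ((m ∸ i) !)
  y  = 1ℚ - fromℕ (suc i)
  y≡ : y ≡ - fromℕ i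
  y≡ = trans (cong (λ t → 1ℚ - t) (fromℕ-suc i)) (cancel (fromℕ i))
    where
    cancel : ∀ a → 1ℚ - (1ℚ + a) ≡ - a
    cancel = solve-∀ ringℚ
  power : (- 1ℚ) ↑ i * y ↑ i ≡ fromℕ i ↑ i
  power = trans (cong (λ t → (- 1ℚ) ↑ i * t ↑ i) y≡) (neg↑ (fromℕ i) i)
  rearrange : ∀ a b c d e → (0ℚ - a * b * c) * (d * e) ≡ (- 1ℚ) * a * c * (b * d * e)
  rearrange = solve-∀ ringℚ

-- A difference of order m+1 is applied to a power of degree m. This is the case a = 1 - M of Abel's
-- identity, in which the base on the right is 0.
cG-dp-sum : ∀ M → Σ≤ M (λ i → cG i * dp (1ℚ - fromℕ i) (M ∸ i)) ≡ oneS M 0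
cG-dp-sum zero    = refl
cG-dp-sum (suc m) = trans (Σ≤-cong (suc m) (cG-dp m)) (diff-vanishes (suc m) 1ℚ m ℕP.≤-refl)

-- The base N - i + a is split as x + (1 - i), where x = N + a - 1 does not involve i. After
-- binomial expansion and exchange of the sums, the inner sum over i is `cG-dp-sum (N ∸ j)`, which
-- is nonzero only for j = N.
abel : ∀ N a → Σ≤ N (λ i → cG i * dp (fromℕ (N ∸ i) + a) (N ∸ i)) ≡ dp (fromℕ N + (a - 1ℚ)) N
abel N a = begin
  Σ≤ N (λ i → cG i * dp (fromℕ (N ∸ i) + a) (N ∸ i))
    ≡⟨ Σ≤-cong N expand ⟩
  Σ≤ N (λ i → Σ≤ (N ∸ i) (λ j → cG i * (dp x j * dp (1ℚ - fromℕ i) (N ∸ i ∸ j))))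
    ≡⟨ Σ≤-triangle N (λ i j → cG i * (dp x j * dp (1ℚ - fromℕ i) (N ∸ i ∸ j))) ⟩
  Σ≤ N (λ j → Σ≤ (N ∸ j) (λ i → cG i * (dp x j * dp (1ℚ - fromℕ i) (N ∸ i ∸ j))))
    ≡⟨ Σ≤-cong N (λ j _ → collect j) ⟩
  Σ≤ N (λ j → dp x j * oneS (N ∸ j) 0)
    ≡⟨ Σ≤-last N (λ j j<N → trans (cong (λ d → dp x j * oneS d 0) (positive j<N)) (*-zeroʳ (dp x j))) ⟩
  dp x N * oneS (N ∸ N) 0
    ≡⟨ trans (cong (λ d → dp x N * oneS d 0) (ℕP.n∸n≡0 N)) (*-identityʳ (dp x N)) ⟩
  dp x N ∎
  where
  x : ℚ
  x = fromℕ N + (a - 1ℚ)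
  regroup : ∀ n i a → n - i + a ≡ n + (a - 1ℚ) + (1ℚ - i)
  regroup = solve-∀ ringℚ
  expand : ∀ i → i ℕ.≤ N → cG i * dp (fromℕ (N ∸ i) + a) (N ∸ i)
         ≡ Σ≤ (N ∸ i) (λ j → cG i * (dp x j * dp (1ℚ - fromℕ i) (N ∸ i ∸ j)))
  expand i i≤N = begin
    cG i * dp (fromℕ (N ∸ i) + a) (N ∸ i)
      ≡⟨ cong (λ t → cG i * dp t (N ∸ i)) (trans (cong (_+ a) (fromℕ-∸ i≤N)) (regroup (fromℕ N) (fromℕ i) a)) ⟩
    cG i * dp (x + (1ℚ - fromℕ i)) (N ∸ i)
      ≡⟨ cong (cG i *_) (dp-+ x (1ℚ - fromℕ i) (N ∸ i)) ⟩
    cG i * Σ≤ (N ∸ i) (λ j → dp x j * dp (1ℚ - fromℕ i) (N ∸ i ∸ j))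
      ≡⟨ sym (Σ≤-*ˡ (N ∸ i) (cG i) _) ⟩
    Σ≤ (N ∸ i) (λ j → cG i * (dp x j * dp (1ℚ - fromℕ i) (N ∸ i ∸ j))) ∎
  ∸-swap : ∀ i j → N ∸ i ∸ j ≡ N ∸ j ∸ i
  ∸-swap i j = trans (ℕP.∸-+-assoc N i j) (trans (cong (N ∸_) (ℕP.+-comm i j)) (sym (ℕP.∸-+-assoc N j i)))
  collect : ∀ j → Σ≤ (N ∸ j) (λ i → cG i * (dp x j * dp (1ℚ - fromℕ i) (N ∸ i ∸ j))) ≡ dp x j * oneS (N ∸ j) 0
  collect j = begin
    Σ≤ (N ∸ j) (λ i → cG i * (dp x j * dp (1ℚ - fromℕ i) (N ∸ i ∸ j)))
      ≡⟨ Σ≤-cong (N ∸ j) (λ i _ → trans (*-swap (cG i) (dp x j) _) (cong (λ d → dp x j * (cG i * dp (1ℚ - fromℕ i) d)) (∸-swap i j))) ⟩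
    Σ≤ (N ∸ j) (λ i → dp x j * (cG i * dp (1ℚ - fromℕ i) (N ∸ j ∸ i)))
      ≡⟨ Σ≤-*ˡ (N ∸ j) (dp x j) _ ⟩
    dp x j * Σ≤ (N ∸ j) (λ i → cG i * dp (1ℚ - fromℕ i) (N ∸ j ∸ i))
      ≡⟨ cong (dp x j *_) (cG-dp-sum (N ∸ j)) ⟩
    dp x j * oneS (N ∸ j) 0 ∎
  positive : ∀ {j} → j ℕ.< N → N ∸ j ≡ suc (N ∸ suc j)
  positive {j} (s≤s j≤) = ℕP.+-∸-assoc 1 j≤

-- With T = x exp(T), these are the coefficients of exp(aT); note G = 1 − exp(−T).
expT : ℚ → ℕ → ℚ
expT a zero    = 1ℚ
expT a (suc n) = dp (fromℕ (suc n) + a) (suc n) - dp (fromℕ n + (a + 1ℚ)) n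

-- This is exp(-T) exp(aT) = exp((a-1)T). The two divided powers in `expT` are treated separately by
-- `abel`, at (n+1, a) and at (n, a+1); the term i = n+1 belongs to the first sum only.
cG-expT : ∀ a N → Σ≤ N (λ i → cG i * expT a (N ∸ i)) ≡ expT (a - 1ℚ) N
cG-expT a zero    = refl
cG-expT a (suc n) = begin
  Σ≤ n (λ i → cG i * expT a (suc n ∸ i)) + cG (suc n) * expT a (n ∸ n)
    ≡⟨ cong₂ _+_ (Σ≤-cong n split) (cong (λ d → cG (suc n) * expT a d) (ℕP.n∸n≡0 n)) ⟩
  Σ≤ n (λ i → f i - g i) + cG (suc n) * 1ℚ
    ≡⟨ cong₂ _+_ (Σ≤-− n f g) (cong (λ d → cG (suc n) * dp (fromℕ d + a) d) (sym (ℕP.n∸n≡0 n))) ⟩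
  Σ≤ n f - Σ≤ n g + f (suc n)
    ≡⟨ rearrange (Σ≤ n f) (Σ≤ n g) (f (suc n)) ⟩
  Σ≤ (suc n) f - Σ≤ n g
    ≡⟨ cong₂ _-_ (abel (suc n) a) (trans (abel n (a + 1ℚ)) (cong (λ t → dp (fromℕ n + t) n) (commute a))) ⟩
  dp (fromℕ (suc n) + (a - 1ℚ)) (suc n) - dp (fromℕ n + (a - 1ℚ + 1ℚ)) n ∎
  where
  f g : ℕ → ℚ
  f i = cG i * dp (fromℕ (suc n ∸ i) + a) (suc n ∸ i)
  g i = cG i * dp (fromℕ (n ∸ i) + (a + 1ℚ)) (n ∸ i)
  rearrange : ∀ a b c → a - b + c ≡ a + c - b
  rearrange = solve-∀ ringℚ
  commute : ∀ a → a + 1ℚ - 1ℚ ≡ a - 1ℚ + 1ℚ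
  commute = solve-∀ ringℚ
  split : ∀ i → i ℕ.≤ n → cG i * expT a (suc n ∸ i) ≡ f i - g i
  split i i≤n rewrite ℕP.+-∸-assoc 1 i≤n = *-distribˡ-− (cG i) _ _

∇ : ℕ → (ℚ → ℚ) → ℚ → ℚ
∇ zero    f x = f x
∇ (suc K) f x = ∇ K f x - ∇ K f (x - 1ℚ)

G-expT : ∀ a N → Σ≤ N (λ i → egf-G i * expT a (N ∸ i)) ≡ expT a N - expT (a - 1ℚ) N
G-expT a N = begin
  Σ≤ N (λ i → egf-G i * expT a (N ∸ i))
    ≡⟨ Σ≤-cong N (λ i _ → complement (oneS i 0) (egf-G i) (expT a (N ∸ i))) ⟩
  Σ≤ N (λ i → oneS i 0 * expT a (N ∸ i) - cG i * expT a (N ∸ i))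
    ≡⟨ Σ≤-− N (λ i → oneS i 0 * expT a (N ∸ i)) _ ⟩
  Σ≤ N (λ i → oneS i 0 * expT a (N ∸ i)) - Σ≤ N (λ i → cG i * expT a (N ∸ i))
    ≡⟨ cong₂ _-_ (trans (Σ≤-first N (λ i → *-zeroˡ (expT a (N ∸ suc i)))) (*-identityˡ (expT a N))) (cG-expT a N) ⟩
  expT a N - expT (a - 1ℚ) N ∎
  where
  complement : ∀ o g e → g * e ≡ o * e - (o - g) * e
  complement = solve-∀ ringℚ

G-∇-expT : ∀ K N a → Σ≤ N (λ i → egf-G i * ∇ K (λ b → expT b (N ∸ i)) a) ≡ ∇ (suc K) (λ b → expT b N) a
G-∇-expT zero    N a = G-expT a N
G-∇-expT (suc K) N a = begin
  Σ≤ N (λ i → egf-G i * (∇ K (λ b → expT b (N ∸ i)) a - ∇ K (λ b → expT b (N ∸ i)) (a - 1ℚ)))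
    ≡⟨ Σ≤-cong N (λ i _ → *-distribˡ-− (egf-G i) _ _) ⟩
  Σ≤ N (λ i → egf-G i * ∇ K (λ b → expT b (N ∸ i)) a - egf-G i * ∇ K (λ b → expT b (N ∸ i)) (a - 1ℚ))
    ≡⟨ Σ≤-− N (λ i → egf-G i * ∇ K (λ b → expT b (N ∸ i)) a) _ ⟩
  Σ≤ N (λ i → egf-G i * ∇ K (λ b → expT b (N ∸ i)) a) - Σ≤ N (λ i → egf-G i * ∇ K (λ b → expT b (N ∸ i)) (a - 1ℚ))
    ≡⟨ cong₂ _-_ (G-∇-expT K N a) (G-∇-expT K N (a - 1ℚ)) ⟩
  ∇ (suc (suc K)) (λ b → expT b N) a ∎

-- Powers of G in the single variable x; `powS-tG` reattaches t.
powG : ℕ → ℕ → ℚ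
powG zero    N = oneS N 0
powG (suc K) N = Σ≤ N (λ i → egf-G i * powG K (N ∸ i))

powG-∇ : ∀ K N → powG K N ≡ ∇ K (λ b → expT b N) 0ℚ
powG-∇ zero    zero    = refl
-- Here exp(0 · T) = 1: both divided powers in `expT 0ℚ (suc n)` have base X = n+1, and X^(n+1) /
-- (n+1)! = X^n / n!.
powG-∇ zero    (suc n) = sym (trans (cong₂ _-_ (cong (λ t → dp t (suc n)) (+-identityʳ X)) (cong (λ t → dp t n) shift)) X-cancel)
  where
  X : ℚ
  X = fromℕ (suc n)
  shift : fromℕ n + (0ℚ + 1ℚ) ≡ X
  shift = trans (ℚP.+-comm (fromℕ n) 1ℚ) (sym (fromℕ-suc n))
  X-cancel : dp X (suc n) - dp X n ≡ 0ℚ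
  X-cancel = trans (cong (_- dp X n) (fromℕ-cancel (suc n) (dp-suc X n))) (ℚP.+-inverseʳ (dp X n))
powG-∇ (suc K) N       = trans (Σ≤-cong N (λ i _ → cong (egf-G i *_) (powG-∇ K (N ∸ i)))) (G-∇-expT K N 0ℚ)

-- The derivative of the power x ↑ N.
dpow : ℕ → ℚ → ℚ
dpow zero    x = 0ℚ
dpow (suc n) x = x * dpow n x + x ↑ n

φ : ℕ → ℚ → ℚ
φ N x = x ↑ N - dpow N x

dpow-suc : ∀ n x → dpow (suc n) x ≡ fromℕ (suc n) * x ↑ n
dpow-suc zero    x = cong (_+ 1ℚ) (*-zeroʳ x)
dpow-suc (suc n) x = begin
  x * dpow (suc n) x + x ↑ suc n              ≡⟨ cong (λ t → x * t + x ↑ suc n) (dpow-suc n x) ⟩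
  x * (fromℕ (suc n) * x ↑ n) + x * x ↑ n     ≡⟨ collect x (fromℕ (suc n)) (x ↑ n) ⟩
  (1ℚ + fromℕ (suc n)) * (x * x ↑ n)          ≡⟨ cong (_* (x * x ↑ n)) (sym (fromℕ-suc (suc n))) ⟩
  fromℕ (suc (suc n)) * (x * x ↑ n)           ∎
  where
  collect : ∀ x a b → x * (a * b) + x * b ≡ (1ℚ + a) * (x * b)
  collect = solve-∀ ringℚ

expT-φ : ∀ N a → fromℕ (N !) * expT a N ≡ φ N (fromℕ N + a)
expT-φ zero    a = refl
expT-φ (suc n) a = begin
  F * (x ↑ suc n * recip (suc n !) - dp (fromℕ n + (a + 1ℚ)) n)    ≡⟨ cong₂ (λ s t → F * (x ↑ suc n * recip (suc n !) - s ↑ n * t)) shift (sym (recip-! n)) ⟩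
  F * (x ↑ suc n * r - x ↑ n * (fromℕ (suc n) * r))                ≡⟨ rearrange F (x ↑ suc n) r (x ↑ n) (fromℕ (suc n)) ⟩
  r * F * (x ↑ suc n - fromℕ (suc n) * x ↑ n)                      ≡⟨ cong (_* (x ↑ suc n - fromℕ (suc n) * x ↑ n)) (recip-inverseˡ (suc n !) {{suc n ℕP.!≢0}}) ⟩
  1ℚ * (x ↑ suc n - fromℕ (suc n) * x ↑ n)                         ≡⟨ *-identityˡ _ ⟩
  x ↑ suc n - fromℕ (suc n) * x ↑ n                                ≡⟨ cong (λ t → x ↑ suc n - t) (sym (dpow-suc n x)) ⟩
  φ (suc n) x                                                      ∎
  where
  F r x : ℚ
  F = fromℕ (suc n !)
  r = recip (suc n !)
  x = fromℕ (suc n) + a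
  reorder : ∀ n a → n + (a + 1ℚ) ≡ 1ℚ + n + a
  reorder = solve-∀ ringℚ
  shift : fromℕ n + (a + 1ℚ) ≡ x
  shift = trans (reorder (fromℕ n) a) (cong (_+ a) (sym (fromℕ-suc n)))
  rearrange : ∀ F p r q m → F * (p * r - q * (m * r)) ≡ r * F * (p - m * q)
  rearrange = solve-∀ ringℚ

∇-scale-shift : ∀ c s {f g : ℚ → ℚ} → (∀ x → c * f x ≡ g (s + x)) → ∀ K x → c * ∇ K f x ≡ ∇ K g (s + x)
∇-scale-shift c s eq zero    x = eq x
∇-scale-shift c s {f} {g} eq (suc K) x = begin
  c * (∇ K f x - ∇ K f (x - 1ℚ))              ≡⟨ *-distribˡ-− c _ _ ⟩
  c * ∇ K f x - c * ∇ K f (x - 1ℚ)            ≡⟨ cong₂ _-_ (∇-scale-shift c s eq K x) (∇-scale-shift c s eq K (x - 1ℚ)) ⟩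
  ∇ K g (s + x) - ∇ K g (s + (x - 1ℚ))        ≡⟨ cong (λ t → ∇ K g (s + x) - ∇ K g t) (sym (ℚP.+-assoc s x (- 1ℚ))) ⟩
  ∇ K g (s + x) - ∇ K g (s + x - 1ℚ)          ∎

powG-φ : ∀ K N → fromℕ (N !) * powG K N ≡ ∇ K (φ N) (fromℕ N)
powG-φ K N = begin
  fromℕ (N !) * powG K N                          ≡⟨ cong (fromℕ (N !) *_) (powG-∇ K N) ⟩
  fromℕ (N !) * ∇ K (λ b → expT b N) 0ℚ           ≡⟨ ∇-scale-shift (fromℕ (N !)) (fromℕ N) (expT-φ N) K 0ℚ ⟩
  ∇ K (φ N) (fromℕ N + 0ℚ)                        ≡⟨ cong (∇ K (φ N)) (+-identityʳ (fromℕ N)) ⟩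
  ∇ K (φ N) (fromℕ N)                             ∎

-- Weighted sums over vectors and acyclic functional graphs

weight : ∀ {m} → (Fin m → A → ℚ) → Vec A m → ℚ
weight α []       = 1ℚ
weight α (x ∷ xs) = α F.zero x * weight (α ∘ F.suc) xs

mapᵢ : ∀ {m} → (Fin m → A → B) → Vec A m → Vec B m
mapᵢ g []       = []
mapᵢ g (x ∷ xs) = g F.zero x ∷ mapᵢ (g ∘ F.suc) xs

lookup-mapᵢ : ∀ {m} (g : Fin m → A → B) (xs : Vec A m) i → lookup (mapᵢ g xs) i ≡ g i (lookup xs i)
lookup-mapᵢ g (x ∷ xs) F.zero    = refl
lookup-mapᵢ g (x ∷ xs) (F.suc i) = lookup-mapᵢ (g ∘ F.suc) xs i

-- Summing over the fibres of mapᵢ g turns the weights α into weights β, coordinate by coordinate.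
∑-pushforward : ∀ {m} (xs : List A) (ys : List B) (g : Fin m → A → B) (α : Fin m → A → ℚ) (β : Fin m → B → ℚ) →
                (∀ i (h : B → ℚ) → ∑ xs (λ a → α i a * h (g i a)) ≡ ∑ ys (λ b → β i b * h b)) →
                ∀ (H : Vec B m → ℚ) →
                ∑ (vecs xs m) (λ v → weight α v * H (mapᵢ g v)) ≡ ∑ (vecs ys m) (λ w → weight β w * H w)
∑-pushforward {m = zero}  xs ys g α β hyp H = refl
∑-pushforward {m = suc m} xs ys g α β hyp H = begin
  ∑ (vecs xs (suc m)) (λ v → weight α v * H (mapᵢ g v))
    ≡⟨ ∑-vecs xs m _ ⟩
  ∑ xs (λ a → ∑ (vecs xs m) (λ v → α F.zero a * weight (α ∘ F.suc) v * H (g F.zero a ∷ mapᵢ (g ∘ F.suc) v)))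
    ≡⟨ ∑-cong xs (λ a → factor xs (α F.zero a) (weight (α ∘ F.suc)) (λ v → H (g F.zero a ∷ mapᵢ (g ∘ F.suc) v))) ⟩
  ∑ xs (λ a → α F.zero a * ∑ (vecs xs m) (λ v → weight (α ∘ F.suc) v * H (g F.zero a ∷ mapᵢ (g ∘ F.suc) v)))
    ≡⟨ ∑-cong xs (λ a → cong (α F.zero a *_) (∑-pushforward xs ys (g ∘ F.suc) (α ∘ F.suc) (β ∘ F.suc) (hyp ∘ F.suc) (λ w → H (g F.zero a ∷ w)))) ⟩
  ∑ xs (λ a → α F.zero a * rest (g F.zero a))
    ≡⟨ hyp F.zero rest ⟩
  ∑ ys (λ b → β F.zero b * rest b)
    ≡⟨ sym (∑-cong ys (λ b → factor ys (β F.zero b) (weight (β ∘ F.suc)) (λ w → H (b ∷ w)))) ⟩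
  ∑ ys (λ b → ∑ (vecs ys m) (λ w → β F.zero b * weight (β ∘ F.suc) w * H (b ∷ w)))
    ≡⟨ sym (∑-vecs ys m _) ⟩
  ∑ (vecs ys (suc m)) (λ w → weight β w * H w) ∎
  where
  rest : _ → ℚ
  rest b = ∑ (vecs ys m) (λ w → weight (β ∘ F.suc) w * H (b ∷ w))
  factor : ∀ {C : Set} (zs : List C) c (u h : Vec C m → ℚ) →
           ∑ (vecs zs m) (λ v → c * u v * h v) ≡ c * ∑ (vecs zs m) (λ v → u v * h v)
  factor zs c u h = trans (∑-cong (vecs zs m) (λ v → ℚP.*-assoc c (u v) (h v))) (∑-*ˡ (vecs zs m) c _)

-- Functional graphs on Fin m with a sink (nothing); a graph is acyclic iff every vertex
-- leads to the sink, which is decided by eliminating the vertices one by one.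

redirect : ∀ {m} → Maybe (Fin m) → Maybe (Fin (suc m)) → Maybe (Fin m)
redirect c nothing          = nothing
redirect c (just F.zero)    = c
redirect c (just (F.suc v)) = just v

acyclic : ∀ {m} → Vec (Maybe (Fin m)) m → Bool
acyclic {zero}  []                    = true
acyclic {suc m} (nothing ∷ q)          = acyclic (V.map (redirect nothing) q)
acyclic {suc m} (just F.zero ∷ q)      = false
acyclic {suc m} (just (F.suc c) ∷ q)   = acyclic (V.map (redirect (just c)) q)

-- Paths into the sink carry no length, because elimination removes the steps that pass through
-- vertex 0.
data Sinks {m} (q : Vec (Maybe (Fin m)) m) : Maybe (Fin m) → Set where
  sink : Sinks q nothing
  step : ∀ {v} → Sinks q (lookup q v) → Sinks q (just v)

module _ {m} (t : Maybe (Fin (suc m))) (c : Maybe (Fin m)) (t↦c : t ≡ Maybe.map F.suc c) (q : Vec (Maybe (Fin (suc m))) m) where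

  private
    q′ = V.map (redirect c) q

    redirect-suc : ∀ c′ → redirect c (Maybe.map F.suc c′) ≡ c′
    redirect-suc nothing  = refl
    redirect-suc (just _) = refl

  -- The hypothesis `t↦c` excludes a loop at vertex 0. A step from 0 simply disappears, because 0
  -- and its target have the same image under `redirect c`.
  Sinks-eliminate : ∀ {x} → Sinks (t ∷ q) x → Sinks q′ (redirect c x)
  Sinks-eliminate sink                   = sink
  Sinks-eliminate (step {F.zero} s)      = subst (Sinks q′) (trans (cong (redirect c) t↦c) (redirect-suc c)) (Sinks-eliminate s)
  Sinks-eliminate (step {F.suc v} s)     = step (subst (Sinks q′) (sym (VP.lookup-map v (redirect c) q)) (Sinks-eliminate s))

  -- A preimage of y under `redirect c` is its shifted copy or, when y = c, possibly vertex 0.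
  -- Quantifying over x covers both; vertex 0 costs one extra step.
  Sinks-restore : ∀ {y} → Sinks q′ y → ∀ x → redirect c x ≡ y → Sinks (t ∷ q) x
  Sinks-restore s            nothing          _    = sink
  Sinks-restore (step {v} s) (just (F.suc .v)) refl = step (Sinks-restore s (lookup q v) (sym (VP.lookup-map v (redirect c) q)))
  Sinks-restore sink         (just F.zero)    c≡ = step (subst (Sinks (t ∷ q)) (sym (trans t↦c (cong (Maybe.map F.suc) c≡))) sink)
  Sinks-restore (step {v} s) (just F.zero)    c≡ =
    step (subst (Sinks (t ∷ q)) (sym (trans t↦c (cong (Maybe.map F.suc) c≡)))
      (step (Sinks-restore s (lookup q v) (sym (VP.lookup-map v (redirect c) q)))))

acyclic⇒Sinks : ∀ {m} (q : Vec (Maybe (Fin m)) m) → acyclic q ≡ true → ∀ x → Sinks q x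
acyclic⇒Sinks {zero}  []                  _  nothing = sink
acyclic⇒Sinks {suc m} (nothing ∷ q)       ac x = Sinks-restore nothing nothing refl q (acyclic⇒Sinks _ ac _) x refl
acyclic⇒Sinks {suc m} (just (F.suc c) ∷ q) ac x = Sinks-restore (just (F.suc c)) (just c) refl q (acyclic⇒Sinks _ ac _) x refl

Sinks⇒acyclic : ∀ {m} (q : Vec (Maybe (Fin m)) m) → (∀ x → Sinks q x) → acyclic q ≡ true
Sinks⇒acyclic {zero}  []                  _ = refl
Sinks⇒acyclic {suc m} (nothing ∷ q)       s = Sinks⇒acyclic (V.map (redirect nothing) q) reach
  where
  reach : ∀ x → Sinks (V.map (redirect nothing) q) x
  reach nothing  = sink
  reach (just v) = Sinks-eliminate nothing nothing refl q (s (just (F.suc v)))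
Sinks⇒acyclic {suc m} (just F.zero ∷ q)   s = ⊥-elim (loop (s (just F.zero)))
  where
  loop : Sinks (just F.zero ∷ q) (just F.zero) → ⊥
  loop (step s) = loop s
Sinks⇒acyclic {suc m} (just (F.suc c) ∷ q) s = Sinks⇒acyclic (V.map (redirect (just c)) q) reach
  where
  reach : ∀ x → Sinks (V.map (redirect (just c)) q) x
  reach nothing  = sink
  reach (just v) = Sinks-eliminate (just (F.suc c)) (just c) refl q (s (just (F.suc v)))

-- Weighted matrix-tree theorem for rank-one edge weights

∏ : ∀ {m} → (Fin m → ℚ) → ℚ
∏ {zero}  y = 1ℚ
∏ {suc m} y = y F.zero * ∏ (y ∘ F.suc)

-- ∂∏ d y = Σ_v d v · Π_{u ≠ v} y u
∂∏ : ∀ {m} → (Fin m → ℚ) → (Fin m → ℚ) → ℚ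
∂∏ {zero}  d y = 0ℚ
∂∏ {suc m} d y = y F.zero * ∂∏ (d ∘ F.suc) (y ∘ F.suc) + d F.zero * ∏ (y ∘ F.suc)

∏-cong : ∀ {m} {y z : Fin m → ℚ} → (∀ v → y v ≡ z v) → ∏ y ≡ ∏ z
∏-cong {zero}  eq = refl
∏-cong {suc m} eq = cong₂ _*_ (eq F.zero) (∏-cong (eq ∘ F.suc))

∂∏-cong : ∀ {m} {d e y z : Fin m → ℚ} → (∀ v → d v ≡ e v) → (∀ v → y v ≡ z v) → ∂∏ d y ≡ ∂∏ e z
∂∏-cong {zero}  eq eq′ = refl
∂∏-cong {suc m} eq eq′ = cong₂ _+_ (cong₂ _*_ (eq′ F.zero) (∂∏-cong (eq ∘ F.suc) (eq′ ∘ F.suc)))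
                                   (cong₂ _*_ (eq F.zero) (∏-cong (eq′ ∘ F.suc)))

∂∏-* : ∀ {m} c (d y : Fin m → ℚ) → ∂∏ (λ v → c * d v) y ≡ c * ∂∏ d y
∂∏-* {zero}  c d y = sym (*-zeroʳ c)
∂∏-* {suc m} c d y = trans (cong (λ t → y F.zero * t + c * d F.zero * ∏ (y ∘ F.suc)) (∂∏-* c (d ∘ F.suc) (y ∘ F.suc)))
                           (rearrange c (y F.zero) (∂∏ (d ∘ F.suc) (y ∘ F.suc)) (d F.zero) (∏ (y ∘ F.suc)))
  where
  rearrange : ∀ c y p d q → y * (c * p) + c * d * q ≡ c * (y * p + d * q)
  rearrange = solve-∀ ringℚ

∂∏-∑ : ∀ {m} (xs : List A) (d : A → Fin m → ℚ) y → ∂∏ (λ v → ∑ xs (λ a → d a v)) y ≡ ∑ xs (λ a → ∂∏ (d a) y)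
∂∏-∑ {m = zero}  xs d y = sym (∑-zero xs)
∂∏-∑ {m = suc m} xs d y = begin
  y F.zero * ∂∏ (λ v → ∑ xs (λ a → d a (F.suc v))) (y ∘ F.suc) + ∑ xs (λ a → d a F.zero) * ∏ (y ∘ F.suc)
    ≡⟨ cong₂ (λ s t → y F.zero * s + t) (∂∏-∑ xs (λ a → d a ∘ F.suc) (y ∘ F.suc)) (sym (∑-*ʳ xs _ _)) ⟩
  y F.zero * ∑ xs (λ a → ∂∏ (d a ∘ F.suc) (y ∘ F.suc)) + ∑ xs (λ a → d a F.zero * ∏ (y ∘ F.suc))
    ≡⟨ cong (_+ ∑ xs (λ a → d a F.zero * ∏ (y ∘ F.suc))) (sym (∑-*ˡ xs (y F.zero) _)) ⟩
  ∑ xs (λ a → y F.zero * ∂∏ (d a ∘ F.suc) (y ∘ F.suc)) + ∑ xs (λ a → d a F.zero * ∏ (y ∘ F.suc))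
    ≡⟨ sym (∑-+ xs _ _) ⟩
  ∑ xs (λ a → ∂∏ (d a) y) ∎

δ : ∀ {m} → Fin m → Fin m → ℚ
δ F.zero    F.zero    = 1ℚ
δ F.zero    (F.suc _) = 0ℚ
δ (F.suc _) F.zero    = 0ℚ
δ (F.suc v) (F.suc w) = δ v w

∑-δ : ∀ {m} (f : Fin m → ℚ) w → ∑ (allFin m) (λ v → δ w v * f v) ≡ f w
∑-δ {suc m} f F.zero    = begin
  ∑ (allFin (suc m)) (λ v → δ F.zero v * f v)                  ≡⟨ ∑-allFin m (λ v → δ F.zero v * f v) ⟩
  1ℚ * f F.zero + ∑ (allFin m) (λ v → 0ℚ * f (F.suc v))        ≡⟨ cong₂ _+_ (*-identityˡ (f F.zero)) (trans (∑-cong (allFin m) (λ v → *-zeroˡ (f (F.suc v)))) (∑-zero (allFin m))) ⟩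
  f F.zero + 0ℚ                                                ≡⟨ +-identityʳ _ ⟩
  f F.zero                                                     ∎
∑-δ {suc m} f (F.suc w) = begin
  ∑ (allFin (suc m)) (λ v → δ (F.suc w) v * f v)               ≡⟨ ∑-allFin m (λ v → δ (F.suc w) v * f v) ⟩
  0ℚ * f F.zero + ∑ (allFin m) (λ v → δ w v * f (F.suc v))     ≡⟨ cong₂ _+_ (*-zeroˡ (f F.zero)) (∑-δ (f ∘ F.suc) w) ⟩
  0ℚ + f (F.suc w)                                             ≡⟨ +-identityˡ _ ⟩
  f (F.suc w)                                                  ∎

δ-sym : ∀ {m} (v w : Fin m) → δ v w ≡ δ w v
δ-sym F.zero    F.zero    = refl
δ-sym F.zero    (F.suc _) = refl
δ-sym (F.suc _) F.zero    = refl
δ-sym (F.suc v) (F.suc w) = δ-sym v w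

targets : ∀ m → List (Maybe (Fin m))
targets m = nothing ∷ L.map just (allFin m)

∑-targets : ∀ m (f : Maybe (Fin m) → ℚ) → ∑ (targets m) f ≡ f nothing + ∑ (allFin m) (f ∘ just)
∑-targets m f = cong (f nothing +_) (∑-map just (allFin m) f)

-- Rank-one weights between vertices together with arbitrary weights to the sink form a family
-- closed under the elimination of a vertex, as the induction in `∑-acyclic` requires.
edge : ∀ {m} (s x w : Fin m → ℚ) → Fin m → Maybe (Fin m) → ℚ
edge s x w v nothing  = w v
edge s x w v (just u) = s v * x u

-- Loops are counted too, so that the Laplacian is exactly the diagonal matrix of these totals minus
-- the rank-one matrix of the s v * x u.
outflow : ∀ {m} (s x w : Fin m → ℚ) → Fin m → ℚ
outflow {m} s x w v = w v + s v * ∑ (allFin m) x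

mapᵢ-const : ∀ {m} (g : A → B) (xs : Vec A m) → mapᵢ (λ _ → g) xs ≡ V.map g xs
mapᵢ-const g []       = refl
mapᵢ-const g (x ∷ xs) = cong (g x ∷_) (mapᵢ-const g xs)

-- Eliminating a vertex whose out-edge goes to c moves the weight of its in-edges to c.
module _ {m} (s x w : Fin (suc m) → ℚ) where

  targetWeight : Maybe (Fin m) → Fin m → ℚ
  targetWeight nothing  v = x (F.suc v)
  targetWeight (just c) v = x (F.suc v) + δ c v * x F.zero

  sinkWeight : Maybe (Fin m) → Fin m → ℚ
  sinkWeight nothing  v = w (F.suc v) + s (F.suc v) * x F.zero
  sinkWeight (just c) v = w (F.suc v)

  redirect-edge : ∀ c v (h : Maybe (Fin m) → ℚ) →
    ∑ (targets (suc m)) (λ t → edge s x w (F.suc v) t * h (redirect c t))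
      ≡ ∑ (targets m) (λ t → edge (s ∘ F.suc) (targetWeight c) (sinkWeight c) v t * h t)
  redirect-edge c v h = begin
    ∑ (targets (suc m)) (λ t → edge s x w (F.suc v) t * h (redirect c t))
      ≡⟨ ∑-targets (suc m) (λ t → edge s x w (F.suc v) t * h (redirect c t)) ⟩
    w′ * h nothing + ∑ (allFin (suc m)) (λ u → s′ * x u * h (redirect c (just u)))
      ≡⟨ cong (w′ * h nothing +_) (∑-allFin m (λ u → s′ * x u * h (redirect c (just u)))) ⟩
    w′ * h nothing + (s′ * x F.zero * h c + ∑ (allFin m) (λ u → s′ * x (F.suc u) * h (just u)))
      ≡⟨ merge c ⟩
    sinkWeight c v * h nothing + ∑ (allFin m) (λ u → s′ * targetWeight c u * h (just u))
      ≡⟨ sym (∑-targets m (λ t → edge (s ∘ F.suc) (targetWeight c) (sinkWeight c) v t * h t)) ⟩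
    ∑ (targets m) (λ t → edge (s ∘ F.suc) (targetWeight c) (sinkWeight c) v t * h t) ∎
    where
    w′ s′ : ℚ
    w′ = w (F.suc v)
    s′ = s (F.suc v)
    regroup : ∀ w h s x r → w * h + (s * x * h + r) ≡ (w + s * x) * h + r
    regroup = solve-∀ ringℚ
    expand : ∀ s x d y h → s * (x + d * y) * h ≡ d * (s * y * h) + s * x * h
    expand = solve-∀ ringℚ
    merge : ∀ c → w′ * h nothing + (s′ * x F.zero * h c + ∑ (allFin m) (λ u → s′ * x (F.suc u) * h (just u)))
          ≡ sinkWeight c v * h nothing + ∑ (allFin m) (λ u → s′ * targetWeight c u * h (just u))
    merge nothing  = regroup w′ (h nothing) s′ (x F.zero) _
    merge (just c) = cong (w′ * h nothing +_) (sym (begin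
      ∑ (allFin m) (λ u → s′ * (x (F.suc u) + δ c u * x F.zero) * h (just u))
        ≡⟨ ∑-cong (allFin m) (λ u → expand s′ (x (F.suc u)) (δ c u) (x F.zero) (h (just u))) ⟩
      ∑ (allFin m) (λ u → δ c u * (s′ * x F.zero * h (just u)) + s′ * x (F.suc u) * h (just u))
        ≡⟨ ∑-+ (allFin m) (λ u → δ c u * (s′ * x F.zero * h (just u))) _ ⟩
      ∑ (allFin m) (λ u → δ c u * (s′ * x F.zero * h (just u))) + ∑ (allFin m) (λ u → s′ * x (F.suc u) * h (just u))
        ≡⟨ cong (_+ ∑ (allFin m) (λ u → s′ * x (F.suc u) * h (just u))) (∑-δ (λ u → s′ * x F.zero * h (just u)) c) ⟩
      s′ * x F.zero * h (just c) + ∑ (allFin m) (λ u → s′ * x (F.suc u) * h (just u)) ∎))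

  -- Elimination only moves weight from one target to another. Hence the product `P` in `∑-acyclic`
  -- is the same for every target c of the eliminated vertex.
  outflow-eliminate : ∀ c v → outflow (s ∘ F.suc) (targetWeight c) (sinkWeight c) v ≡ outflow s x w (F.suc v)
  outflow-eliminate nothing  v = trans (regroup (w (F.suc v)) (s (F.suc v)) (x F.zero) _) (cong (λ t → w (F.suc v) + s (F.suc v) * t) (sym (∑-allFin m x)))
    where
    regroup : ∀ w s x X → w + s * x + s * X ≡ w + s * (x + X)
    regroup = solve-∀ ringℚ
  outflow-eliminate (just c) v = cong (λ t → w (F.suc v) + s (F.suc v) * t) (begin
    ∑ (allFin m) (λ u → x (F.suc u) + δ c u * x F.zero)                            ≡⟨ ∑-+ (allFin m) (x ∘ F.suc) _ ⟩
    ∑ (allFin m) (x ∘ F.suc) + ∑ (allFin m) (λ u → δ c u * x F.zero)               ≡⟨ cong (∑ (allFin m) (x ∘ F.suc) +_) (∑-δ (λ _ → x F.zero) c) ⟩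
    ∑ (allFin m) (x ∘ F.suc) + x F.zero                                            ≡⟨ ℚP.+-comm _ (x F.zero) ⟩
    x F.zero + ∑ (allFin m) (x ∘ F.suc)                                            ≡⟨ sym (∑-allFin m x) ⟩
    ∑ (allFin (suc m)) x                                                           ∎)

-- An instance of the weighted matrix-tree theorem: the Laplacian is a diagonal matrix
-- minus a matrix of rank one.
∑-acyclic : ∀ {m} (s x w : Fin m → ℚ) →
            ∑ (vecs (targets m) m) (λ q → weight (edge s x w) q * ⟦ acyclic q ⟧)
              ≡ ∏ (outflow s x w) - ∂∏ (λ v → s v * x v) (outflow s x w)
∑-acyclic {zero}  s x w = refl
∑-acyclic {suc m} s x w = begin
  ∑ (vecs (targets (suc m)) (suc m)) (λ q → weight (edge s x w) q * ⟦ acyclic q ⟧)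
    ≡⟨ ∑-vecs (targets (suc m)) m _ ⟩
  ∑ (targets (suc m)) (λ t → ∑ Q (λ q → edge s x w F.zero t * weight (edge s x w ∘ F.suc) q * ⟦ acyclic (t ∷ q) ⟧))
    ≡⟨ ∑-cong (targets (suc m)) (λ t → trans (∑-cong Q (λ q → ℚP.*-assoc (edge s x w F.zero t) (weight (edge s x w ∘ F.suc) q) ⟦ acyclic (t ∷ q) ⟧)) (∑-*ˡ Q (edge s x w F.zero t) _)) ⟩
  ∑ (targets (suc m)) (λ t → edge s x w F.zero t * eliminated t)
    ≡⟨ trans (∑-targets (suc m) (λ t → edge s x w F.zero t * eliminated t)) (cong (w F.zero * eliminated nothing +_) (∑-allFin m (λ u → s F.zero * x u * eliminated (just u)))) ⟩
  w F.zero * eliminated nothing + (s F.zero * x F.zero * eliminated (just F.zero) + ∑ (allFin m) (λ c → s F.zero * x (F.suc c) * eliminated (just (F.suc c))))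
    ≡⟨ cong₂ (λ a b → w F.zero * a + b) (elimination nothing) (cong₂ (λ a b → s F.zero * x F.zero * a + b) loop (∑-cong (allFin m) (λ c → cong (s F.zero * x (F.suc c) *_) (elimination (just c))))) ⟩
  w F.zero * (P - D nothing) + (s F.zero * x F.zero * 0ℚ + ∑ (allFin m) (λ c → s F.zero * x (F.suc c) * (P - D (just c))))
    ≡⟨ cong (λ a → w F.zero * (P - D nothing) + (s F.zero * x F.zero * 0ℚ + a)) toVertices ⟩
  w F.zero * (P - D nothing) + (s F.zero * x F.zero * 0ℚ + s F.zero * (X * P - (X + x F.zero) * D nothing))
    ≡⟨ conclude (w F.zero) (s F.zero) (x F.zero) X P (D nothing) ⟩
  (w F.zero + s F.zero * (x F.zero + X)) * P - ((w F.zero + s F.zero * (x F.zero + X)) * D nothing + s F.zero * x F.zero * P)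
    ≡⟨ cong (λ t → (w F.zero + s F.zero * t) * P - ((w F.zero + s F.zero * t) * D nothing + s F.zero * x F.zero * P)) (sym (∑-allFin m x)) ⟩
  ∏ (outflow s x w) - ∂∏ (λ v → s v * x v) (outflow s x w) ∎
  where
  Q : List (Vec (Maybe (Fin (suc m))) m)
  Q = vecs (targets (suc m)) m
  eliminated : Maybe (Fin (suc m)) → ℚ
  eliminated t = ∑ Q (λ q → weight (edge s x w ∘ F.suc) q * ⟦ acyclic (t ∷ q) ⟧)
  y : Fin m → ℚ
  y = outflow s x w ∘ F.suc
  X P : ℚ
  X = ∑ (allFin m) (x ∘ F.suc)
  P = ∏ y
  D : Maybe (Fin m) → ℚ
  D c = ∂∏ (λ v → s (F.suc v) * targetWeight s x w c v) y
  loop : eliminated (just F.zero) ≡ 0ℚ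
  loop = trans (∑-cong Q (λ q → *-zeroʳ (weight (edge s x w ∘ F.suc) q))) (∑-zero Q)
  acyclic-∷ : ∀ c q → acyclic (Maybe.map F.suc c ∷ q) ≡ acyclic (V.map (redirect c) q)
  acyclic-∷ nothing  q = refl
  acyclic-∷ (just c) q = refl
  elimination : ∀ c → eliminated (Maybe.map F.suc c) ≡ P - D c
  elimination c = begin
    ∑ Q (λ q → weight (edge s x w ∘ F.suc) q * ⟦ acyclic (Maybe.map F.suc c ∷ q) ⟧)
      ≡⟨ ∑-cong Q (λ q → cong (λ b → weight (edge s x w ∘ F.suc) q * ⟦ b ⟧) (trans (acyclic-∷ c q) (cong acyclic (sym (mapᵢ-const (redirect c) q))))) ⟩
    ∑ Q (λ q → weight (edge s x w ∘ F.suc) q * ⟦ acyclic (mapᵢ (λ _ → redirect c) q) ⟧)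
      ≡⟨ ∑-pushforward (targets (suc m)) (targets m) (λ _ → redirect c) (edge s x w ∘ F.suc)
           (edge (s ∘ F.suc) (targetWeight s x w c) (sinkWeight s x w c)) (redirect-edge s x w c) (λ q → ⟦ acyclic q ⟧) ⟩
    ∑ (vecs (targets m) m) (λ q → weight (edge (s ∘ F.suc) (targetWeight s x w c) (sinkWeight s x w c)) q * ⟦ acyclic q ⟧)
      ≡⟨ ∑-acyclic (s ∘ F.suc) (targetWeight s x w c) (sinkWeight s x w c) ⟩
    ∏ (outflow (s ∘ F.suc) (targetWeight s x w c) (sinkWeight s x w c))
      - ∂∏ (λ v → s (F.suc v) * targetWeight s x w c v) (outflow (s ∘ F.suc) (targetWeight s x w c) (sinkWeight s x w c))
      ≡⟨ cong₂ _-_ (∏-cong (outflow-eliminate s x w c)) (∂∏-cong (λ _ → refl) (outflow-eliminate s x w c)) ⟩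
    P - D c ∎
  toVertices : ∑ (allFin m) (λ c → s F.zero * x (F.suc c) * (P - D (just c))) ≡ s F.zero * (X * P - (X + x F.zero) * D nothing)
  toVertices = begin
    ∑ (allFin m) (λ c → s F.zero * x (F.suc c) * (P - D (just c)))
      ≡⟨ trans (∑-cong (allFin m) (λ c → distrib (s F.zero) (x (F.suc c)) P (D (just c)))) (∑-*ˡ (allFin m) (s F.zero) _) ⟩
    s F.zero * ∑ (allFin m) (λ c → x (F.suc c) * P - x (F.suc c) * D (just c))
      ≡⟨ cong (s F.zero *_) (trans (∑-− (allFin m) (λ c → x (F.suc c) * P) _) (cong₂ _-_ (∑-*ʳ (allFin m) P _) derivative)) ⟩
    s F.zero * (X * P - (X + x F.zero) * D nothing) ∎
    where
    distrib : ∀ s x p d → s * x * (p - d) ≡ s * (x * p - x * d)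
    distrib = solve-∀ ringℚ
    expand : ∀ c s v d z → c * (s * (v + d * z)) ≡ c * (s * v) + d * (c * (s * z))
    expand = solve-∀ ringℚ
    collect : ∀ X s v z → X * (s * v) + v * (s * z) ≡ (X + z) * (s * v)
    collect = solve-∀ ringℚ
    column : ∀ v → ∑ (allFin m) (λ c → x (F.suc c) * (s (F.suc v) * (x (F.suc v) + δ c v * x F.zero))) ≡ (X + x F.zero) * (s (F.suc v) * x (F.suc v))
    column v = begin
      ∑ (allFin m) (λ c → x (F.suc c) * (s (F.suc v) * (x (F.suc v) + δ c v * x F.zero)))
        ≡⟨ ∑-cong (allFin m) (λ c → trans (expand (x (F.suc c)) (s (F.suc v)) (x (F.suc v)) (δ c v) (x F.zero)) (cong (λ t → x (F.suc c) * (s (F.suc v) * x (F.suc v)) + t * (x (F.suc c) * (s (F.suc v) * x F.zero))) (δ-sym c v))) ⟩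
      ∑ (allFin m) (λ c → x (F.suc c) * (s (F.suc v) * x (F.suc v)) + δ v c * (x (F.suc c) * (s (F.suc v) * x F.zero)))
        ≡⟨ ∑-+ (allFin m) (λ c → x (F.suc c) * (s (F.suc v) * x (F.suc v))) _ ⟩
      ∑ (allFin m) (λ c → x (F.suc c) * (s (F.suc v) * x (F.suc v))) + ∑ (allFin m) (λ c → δ v c * (x (F.suc c) * (s (F.suc v) * x F.zero)))
        ≡⟨ cong₂ _+_ (∑-*ʳ (allFin m) (s (F.suc v) * x (F.suc v)) _) (∑-δ (λ c → x (F.suc c) * (s (F.suc v) * x F.zero)) v) ⟩
      X * (s (F.suc v) * x (F.suc v)) + x (F.suc v) * (s (F.suc v) * x F.zero)
        ≡⟨ collect X (s (F.suc v)) (x (F.suc v)) (x F.zero) ⟩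
      (X + x F.zero) * (s (F.suc v) * x (F.suc v)) ∎
    -- The rank-one shape enters here: the moved weight δ c v · x 0, summed against x c, gives x v ·
    -- x 0, a multiple of the original target weight. By linearity of `∂∏` the sum over all targets
    -- c collapses to a multiple of `D nothing`.
    derivative : ∑ (allFin m) (λ c → x (F.suc c) * D (just c)) ≡ (X + x F.zero) * D nothing
    derivative = begin
      ∑ (allFin m) (λ c → x (F.suc c) * D (just c))
        ≡⟨ sym (∑-cong (allFin m) (λ c → ∂∏-* (x (F.suc c)) _ y)) ⟩
      ∑ (allFin m) (λ c → ∂∏ (λ v → x (F.suc c) * (s (F.suc v) * (x (F.suc v) + δ c v * x F.zero))) y)
        ≡⟨ sym (∂∏-∑ (allFin m) (λ c v → x (F.suc c) * (s (F.suc v) * (x (F.suc v) + δ c v * x F.zero))) y) ⟩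
      ∂∏ (λ v → ∑ (allFin m) (λ c → x (F.suc c) * (s (F.suc v) * (x (F.suc v) + δ c v * x F.zero)))) y
        ≡⟨ ∂∏-cong column (λ _ → refl) ⟩
      ∂∏ (λ v → (X + x F.zero) * (s (F.suc v) * x (F.suc v))) y
        ≡⟨ ∂∏-* (X + x F.zero) _ y ⟩
      (X + x F.zero) * D nothing ∎
  conclude : ∀ w s x X P D → w * (P - D) + (s * x * 0ℚ + s * (X * P - (X + x) * D))
           ≡ (w + s * (x + X)) * P - ((w + s * (x + X)) * D + s * x * P)
  conclude = solve-∀ ringℚ

-- Parent choices for a prescribed maximal decreasing subtree

size : ∀ {m} → Vec Bool m → ℕ
size []          = 0
size (true ∷ R)  = suc (size R)
size (false ∷ R) = size R

above : ∀ {m} → Vec Bool m → Fin m → ℕ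
above (_ ∷ R) F.zero    = size R
above (_ ∷ R) (F.suc v) = above R v

-- The accumulator j stands for elements of R already passed, so that a scan of the vertices can
-- resume at any point.
below : ∀ {m} → ℕ → Vec Bool m → Fin m → ℕ
below j (_ ∷ R) F.zero    = j
below j (b ∷ R) (F.suc v) = below (if b then suc j else j) R v

∑-size : ∀ {m} (R : Vec Bool m) → ∑ (allFin m) (λ u → ⟦ lookup R u ⟧) ≡ fromℕ (size R)
∑-size []                  = refl
∑-size {suc m} (true ∷ R)  = trans (∑-allFin m (λ u → ⟦ lookup (true ∷ R) u ⟧)) (trans (cong (1ℚ +_) (∑-size R)) (sym (fromℕ-suc (size R))))
∑-size {suc m} (false ∷ R) = trans (∑-allFin m (λ u → ⟦ lookup (false ∷ R) u ⟧)) (trans (+-identityˡ _) (∑-size R))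

∑-not : ∀ {m} (R : Vec Bool m) → ∑ (allFin m) (λ u → ⟦ not (lookup R u) ⟧) ≡ fromℕ m - fromℕ (size R)
∑-not []                  = refl
∑-not {suc m} (true ∷ R)  = begin
  ∑ (allFin (suc m)) (λ u → ⟦ not (lookup (true ∷ R) u) ⟧)     ≡⟨ trans (∑-allFin m (λ u → ⟦ not (lookup (true ∷ R) u) ⟧)) (cong (0ℚ +_) (∑-not R)) ⟩
  0ℚ + (fromℕ m - fromℕ (size R))                              ≡⟨ shift (fromℕ m) (fromℕ (size R)) ⟩
  1ℚ + fromℕ m - (1ℚ + fromℕ (size R))                         ≡⟨ sym (cong₂ _-_ (fromℕ-suc m) (fromℕ-suc (size R))) ⟩
  fromℕ (suc m) - fromℕ (suc (size R))                         ∎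
  where
  shift : ∀ a b → 0ℚ + (a - b) ≡ 1ℚ + a - (1ℚ + b)
  shift = solve-∀ ringℚ
∑-not {suc m} (false ∷ R) = begin
  ∑ (allFin (suc m)) (λ u → ⟦ not (lookup (false ∷ R) u) ⟧)    ≡⟨ trans (∑-allFin m (λ u → ⟦ not (lookup (false ∷ R) u) ⟧)) (cong (1ℚ +_) (∑-not R)) ⟩
  1ℚ + (fromℕ m - fromℕ (size R))                              ≡⟨ sym (ℚP.+-assoc 1ℚ (fromℕ m) _) ⟩
  1ℚ + fromℕ m - fromℕ (size R)                                ≡⟨ cong (_- fromℕ (size R)) (sym (fromℕ-suc m)) ⟩
  fromℕ (suc m) - fromℕ (size R)                               ∎

∑-below : ∀ {m} j (R : Vec Bool m) v →
          fromℕ j + ∑ (allFin m) (λ u → ⟦ lookup R u ∧ (toℕ u ℕ.<ᵇ toℕ v) ⟧) ≡ fromℕ (below j R v)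
∑-below {suc m} j (b ∷ R) F.zero    =
  trans (cong (fromℕ j +_) (trans (∑-cong (allFin (suc m)) (λ u → cong ⟦_⟧ (BP.∧-zeroʳ (lookup (b ∷ R) u)))) (∑-zero (allFin (suc m))))) (+-identityʳ (fromℕ j))
∑-below {suc m} j (b ∷ R) (F.suc v) = begin
  fromℕ j + ∑ (allFin (suc m)) (λ u → ⟦ lookup (b ∷ R) u ∧ (toℕ u ℕ.<ᵇ suc (toℕ v)) ⟧)
    ≡⟨ cong (fromℕ j +_) (∑-allFin m (λ u → ⟦ lookup (b ∷ R) u ∧ (toℕ u ℕ.<ᵇ suc (toℕ v)) ⟧)) ⟩
  fromℕ j + (⟦ b ∧ true ⟧ + ∑ (allFin m) (λ u → ⟦ lookup R u ∧ (toℕ u ℕ.<ᵇ toℕ v) ⟧))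
    ≡⟨ sym (ℚP.+-assoc (fromℕ j) _ _) ⟩
  fromℕ j + ⟦ b ∧ true ⟧ + ∑ (allFin m) (λ u → ⟦ lookup R u ∧ (toℕ u ℕ.<ᵇ toℕ v) ⟧)
    ≡⟨ cong (_+ ∑ (allFin m) (λ u → ⟦ lookup R u ∧ (toℕ u ℕ.<ᵇ toℕ v) ⟧)) (increment b) ⟩
  fromℕ (if b then suc j else j) + ∑ (allFin m) (λ u → ⟦ lookup R u ∧ (toℕ u ℕ.<ᵇ toℕ v) ⟧)
    ≡⟨ ∑-below (if b then suc j else j) R v ⟩
  fromℕ (below j (b ∷ R) (F.suc v)) ∎
  where
  increment : ∀ b → fromℕ j + ⟦ b ∧ true ⟧ ≡ fromℕ (if b then suc j else j)
  increment true  = trans (ℚP.+-comm (fromℕ j) 1ℚ) (sym (fromℕ-suc j))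
  increment false = +-identityʳ (fromℕ j)

-- The Boolean c is the permission for v to be its own parent; `outflow-choices` takes it to be the
-- test that v is the largest element of R.
∑-above : ∀ {m} (R : Vec Bool m) v c →
          ∑ (allFin m) (λ u → ⟦ lookup R u ∧ ((toℕ v ℕ.<ᵇ toℕ u) ∨ ((toℕ v ℕ.≡ᵇ toℕ u) ∧ c)) ⟧) ≡ fromℕ (above R v) + ⟦ lookup R v ∧ c ⟧
∑-above {suc m} (b ∷ R) F.zero    c = begin
  ∑ (allFin (suc m)) f                                   ≡⟨ ∑-allFin m f ⟩
  ⟦ b ∧ c ⟧ + ∑ (allFin m) (λ u → ⟦ lookup R u ∧ true ⟧)  ≡⟨ cong (⟦ b ∧ c ⟧ +_) (trans (∑-cong (allFin m) (λ u → cong ⟦_⟧ (BP.∧-identityʳ (lookup R u)))) (∑-size R)) ⟩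
  ⟦ b ∧ c ⟧ + fromℕ (size R)                             ≡⟨ ℚP.+-comm ⟦ b ∧ c ⟧ _ ⟩
  fromℕ (size R) + ⟦ b ∧ c ⟧                             ∎
  where
  f : Fin (suc m) → ℚ
  f u = ⟦ lookup (b ∷ R) u ∧ ((0 ℕ.<ᵇ toℕ u) ∨ ((0 ℕ.≡ᵇ toℕ u) ∧ c)) ⟧
∑-above {suc m} (b ∷ R) (F.suc v) c = begin
  ∑ (allFin (suc m)) f                                   ≡⟨ ∑-allFin m f ⟩
  ⟦ b ∧ false ⟧ + ∑ (allFin m) (f ∘ F.suc)               ≡⟨ cong₂ _+_ (cong ⟦_⟧ (BP.∧-zeroʳ b)) (∑-above R v c) ⟩
  0ℚ + (fromℕ (above R v) + ⟦ lookup R v ∧ c ⟧)          ≡⟨ +-identityˡ _ ⟩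
  fromℕ (above R v) + ⟦ lookup R v ∧ c ⟧                 ∎
  where
  f : Fin (suc m) → ℚ
  f u = ⟦ lookup (b ∷ R) u ∧ ((suc (toℕ v) ℕ.<ᵇ toℕ u) ∨ ((suc (toℕ v) ℕ.≡ᵇ toℕ u) ∧ c)) ⟧

-- The condition on the parent u of v for R to be the maximal decreasing subtree.
local : ∀ {m} → Vec Bool m → Fin m → Fin m → Bool
local R v u = if lookup R v
  then lookup R u ∧ ((toℕ v ℕ.<ᵇ toℕ u) ∨ ((toℕ v ℕ.≡ᵇ toℕ u) ∧ (above R v ℕ.≡ᵇ 0)))
  else not (lookup R u) ∨ (toℕ u ℕ.<ᵇ toℕ v)

-- Inside R the local conditions already force every path up to the largest element, so all of R is
-- merged with the sink and cycles need to be excluded only outside R.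
contract : ∀ {m} → Vec Bool m → Fin m → Fin m → Maybe (Fin m)
contract R v u = if lookup R v ∨ lookup R u then nothing else just u

-- The number of parents allowed to a vertex of R with r elements of R above it:
-- the largest element of R is the root, its own parent.
κ : ℕ → ℚ
κ zero    = 1ℚ
κ (suc r) = fromℕ (suc r)

-- The y_v of the overview, with the values on R included. The parameter z is the number of vertices
-- outside R; it is kept free because the scan shortens R while z stays fixed.
choices : ∀ {m} → ℚ → ℕ → Vec Bool m → Fin m → ℚ
choices z j R v = if lookup R v then κ (above R v) else z + fromℕ (below j R v)

outside : ∀ {m} → Vec Bool m → Fin m → ℚ
outside R v = ⟦ not (lookup R v) ⟧

toSink : ∀ {m} → Vec Bool m → Fin m → ℚ
toSink {m} R v = ∑ (allFin m) (λ u → ⟦ local R v u ⟧ * ⟦ lookup R v ∨ lookup R u ⟧)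

-- Between two vertices outside R `local` always holds, and every other edge ends in the sink; so
-- the weights that remain are a product of two indicators, hence of rank one.
contract-edge : ∀ {m} (R : Vec Bool m) v (h : Maybe (Fin m) → ℚ) →
  ∑ (allFin m) (λ u → ⟦ local R v u ⟧ * h (contract R v u))
    ≡ ∑ (targets m) (λ t → edge (outside R) (outside R) (toSink R) v t * h t)
contract-edge {m} R v h = begin
  ∑ (allFin m) (λ u → ⟦ local R v u ⟧ * h (contract R v u))
    ≡⟨ ∑-cong (allFin m) pointwise ⟩
  ∑ (allFin m) (λ u → ⟦ local R v u ⟧ * ⟦ lookup R v ∨ lookup R u ⟧ * h nothing + outside R v * outside R u * h (just u))
    ≡⟨ ∑-+ (allFin m) (λ u → ⟦ local R v u ⟧ * ⟦ lookup R v ∨ lookup R u ⟧ * h nothing) _ ⟩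
  ∑ (allFin m) (λ u → ⟦ local R v u ⟧ * ⟦ lookup R v ∨ lookup R u ⟧ * h nothing) + ∑ (allFin m) (λ u → outside R v * outside R u * h (just u))
    ≡⟨ cong (_+ ∑ (allFin m) (λ u → outside R v * outside R u * h (just u))) (∑-*ʳ (allFin m) (h nothing) _) ⟩
  toSink R v * h nothing + ∑ (allFin m) (λ u → outside R v * outside R u * h (just u))
    ≡⟨ sym (∑-targets m (λ t → edge (outside R) (outside R) (toSink R) v t * h t)) ⟩
  ∑ (targets m) (λ t → edge (outside R) (outside R) (toSink R) v t * h t) ∎
  where
  absorbed : ∀ l a o k → l * a ≡ l * 1ℚ * a + 0ℚ * o * k
  absorbed = solve-∀ ringℚ
  absorbed′ : ∀ l a k → l * a ≡ l * 1ℚ * a + 1ℚ * 0ℚ * k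
  absorbed′ = solve-∀ ringℚ
  kept : ∀ a k → 1ℚ * k ≡ 1ℚ * 0ℚ * a + 1ℚ * 1ℚ * k
  kept = solve-∀ ringℚ
  pointwise : ∀ u → ⟦ local R v u ⟧ * h (contract R v u)
            ≡ ⟦ local R v u ⟧ * ⟦ lookup R v ∨ lookup R u ⟧ * h nothing + outside R v * outside R u * h (just u)
  pointwise u with lookup R v | lookup R u
  ... | true  | b     = absorbed ⟦ b ∧ ((toℕ v ℕ.<ᵇ toℕ u) ∨ ((toℕ v ℕ.≡ᵇ toℕ u) ∧ (above R v ℕ.≡ᵇ 0))) ⟧ (h nothing) ⟦ not b ⟧ (h (just u))
  ... | false | true  = absorbed′ ⟦ toℕ u ℕ.<ᵇ toℕ v ⟧ (h nothing) (h (just u))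
  ... | false | false = kept (h nothing) (h (just u))

outflow-choices : ∀ {m} (R : Vec Bool m) v →
                  outflow (outside R) (outside R) (toSink R) v ≡ choices (fromℕ m - fromℕ (size R)) 0 R v
outflow-choices {m} R v with lookup R v in Rv
... | true  = begin
  ∑ (allFin m) (λ u → ⟦ lookup R u ∧ c u ⟧ * 1ℚ) + 0ℚ * ∑ (allFin m) (outside R)
    ≡⟨ cong₂ _+_ (∑-cong (allFin m) (λ u → *-identityʳ ⟦ lookup R u ∧ c u ⟧)) (*-zeroˡ (∑ (allFin m) (outside R))) ⟩
  ∑ (allFin m) (λ u → ⟦ lookup R u ∧ c u ⟧) + 0ℚ
    ≡⟨ trans (+-identityʳ _) (∑-above R v (above R v ℕ.≡ᵇ 0)) ⟩
  fromℕ (above R v) + ⟦ lookup R v ∧ (above R v ℕ.≡ᵇ 0) ⟧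
    ≡⟨ cong (λ b → fromℕ (above R v) + ⟦ b ∧ (above R v ℕ.≡ᵇ 0) ⟧) Rv ⟩
  fromℕ (above R v) + ⟦ above R v ℕ.≡ᵇ 0 ⟧
    ≡⟨ κ-value (above R v) ⟩
  κ (above R v) ∎
  where
  c : Fin m → Bool
  c u = (toℕ v ℕ.<ᵇ toℕ u) ∨ ((toℕ v ℕ.≡ᵇ toℕ u) ∧ (above R v ℕ.≡ᵇ 0))
  κ-value : ∀ a → fromℕ a + ⟦ a ℕ.≡ᵇ 0 ⟧ ≡ κ a
  κ-value zero    = refl
  κ-value (suc a) = +-identityʳ _
... | false = begin
  ∑ (allFin m) (λ u → ⟦ not (lookup R u) ∨ (toℕ u ℕ.<ᵇ toℕ v) ⟧ * ⟦ lookup R u ⟧) + 1ℚ * ∑ (allFin m) (outside R)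
    ≡⟨ cong₂ _+_ (∑-cong (allFin m) (λ u → simplify (lookup R u) (toℕ u ℕ.<ᵇ toℕ v))) (trans (*-identityˡ _) (∑-not R)) ⟩
  ∑ (allFin m) (λ u → ⟦ lookup R u ∧ (toℕ u ℕ.<ᵇ toℕ v) ⟧) + (fromℕ m - fromℕ (size R))
    ≡⟨ ℚP.+-comm _ (fromℕ m - fromℕ (size R)) ⟩
  fromℕ m - fromℕ (size R) + ∑ (allFin m) (λ u → ⟦ lookup R u ∧ (toℕ u ℕ.<ᵇ toℕ v) ⟧)
    ≡⟨ cong (fromℕ m - fromℕ (size R) +_) (trans (sym (+-identityˡ _)) (∑-below 0 R v)) ⟩
  fromℕ m - fromℕ (size R) + fromℕ (below 0 R v) ∎
  where
  simplify : ∀ a b → ⟦ not a ∨ b ⟧ * ⟦ a ⟧ ≡ ⟦ a ∧ b ⟧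
  simplify true  b = *-identityʳ ⟦ b ⟧
  simplify false b = refl

forestWeight : ∀ {m} → ℚ → ℕ → Vec Bool m → ℚ
forestWeight z j R = ∏ (choices z j R) - ∂∏ (outside R) (choices z j R)

∑-local-acyclic : ∀ {m} (R : Vec Bool m) →
  ∑ (vecs (allFin m) m) (λ p → weight (λ v u → ⟦ local R v u ⟧) p * ⟦ acyclic (mapᵢ (contract R) p) ⟧)
    ≡ forestWeight (fromℕ m - fromℕ (size R)) 0 R
∑-local-acyclic {m} R = begin
  ∑ (vecs (allFin m) m) (λ p → weight (λ v u → ⟦ local R v u ⟧) p * ⟦ acyclic (mapᵢ (contract R) p) ⟧)
    ≡⟨ ∑-pushforward (allFin m) (targets m) (contract R) (λ v u → ⟦ local R v u ⟧) (edge s s (toSink R)) (contract-edge R) (λ q → ⟦ acyclic q ⟧) ⟩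
  ∑ (vecs (targets m) m) (λ q → weight (edge s s (toSink R)) q * ⟦ acyclic q ⟧)
    ≡⟨ ∑-acyclic s s (toSink R) ⟩
  ∏ (outflow s s (toSink R)) - ∂∏ (λ v → s v * s v) (outflow s s (toSink R))
    ≡⟨ cong₂ _-_ (∏-cong (outflow-choices R)) (∂∏-cong (λ v → idempotent (not (lookup R v))) (outflow-choices R)) ⟩
  forestWeight (fromℕ m - fromℕ (size R)) 0 R ∎
  where
  s : Fin m → ℚ
  s = outside R
  idempotent : ∀ b → ⟦ b ⟧ * ⟦ b ⟧ ≡ ⟦ b ⟧
  idempotent true  = refl
  idempotent false = refl

-- Sums over subsets of prescribed size

bools : List Bool
bools = true ∷ false ∷ []

∑ₛ : ∀ m → ℕ → (Vec Bool m → ℚ) → ℚ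
∑ₛ m r f = ∑ (vecs bools m) (λ R → ⟦ size R ℕ.≡ᵇ r ⟧ * f R)

∑ₛ-cong : ∀ m r {f g : Vec Bool m → ℚ} → (∀ R → size R ≡ r → f R ≡ g R) → ∑ₛ m r f ≡ ∑ₛ m r g
∑ₛ-cong m r {f} {g} eq = ∑-cong (vecs bools m) pointwise
  where
  pointwise : ∀ R → ⟦ size R ℕ.≡ᵇ r ⟧ * f R ≡ ⟦ size R ℕ.≡ᵇ r ⟧ * g R
  pointwise R with size R ℕ.≡ᵇ r in same
  ... | true  = cong (1ℚ *_) (eq R (ℕP.≡ᵇ⇒≡ (size R) r (subst T (sym same) tt)))
  ... | false = trans (*-zeroˡ (f R)) (sym (*-zeroˡ (g R)))

∑ₛ-*ˡ : ∀ m r c f → ∑ₛ m r (λ R → c * f R) ≡ c * ∑ₛ m r f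
∑ₛ-*ˡ m r c f = trans (∑-cong (vecs bools m) (λ R → *-swap ⟦ size R ℕ.≡ᵇ r ⟧ c (f R))) (∑-*ˡ (vecs bools m) c _)

∑ₛ-− : ∀ m r f g → ∑ₛ m r (λ R → f R - g R) ≡ ∑ₛ m r f - ∑ₛ m r g
∑ₛ-− m r f g = trans (∑-cong (vecs bools m) (λ R → *-distribˡ-− ⟦ size R ℕ.≡ᵇ r ⟧ (f R) (g R))) (∑-− (vecs bools m) (λ R → ⟦ size R ℕ.≡ᵇ r ⟧ * f R) _)

∑ₛ-zero : ∀ m f → ∑ₛ (suc m) 0 f ≡ ∑ₛ m 0 (λ R → f (false ∷ R))
∑ₛ-zero m f = begin
  ∑ (vecs bools (suc m)) (λ R → ⟦ size R ℕ.≡ᵇ 0 ⟧ * f R)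
    ≡⟨ ∑-vecs bools m (λ R → ⟦ size R ℕ.≡ᵇ 0 ⟧ * f R) ⟩
  ∑ (vecs bools m) (λ R → 0ℚ * f (true ∷ R)) + (∑ₛ m 0 (λ R → f (false ∷ R)) + 0ℚ)
    ≡⟨ cong₂ _+_ (trans (∑-cong (vecs bools m) (λ R → *-zeroˡ (f (true ∷ R)))) (∑-zero (vecs bools m))) (+-identityʳ (∑ₛ m 0 (λ R → f (false ∷ R)))) ⟩
  0ℚ + ∑ₛ m 0 (λ R → f (false ∷ R))
    ≡⟨ +-identityˡ _ ⟩
  ∑ₛ m 0 (λ R → f (false ∷ R)) ∎

∑ₛ-suc : ∀ m r f → ∑ₛ (suc m) (suc r) f ≡ ∑ₛ m r (λ R → f (true ∷ R)) + ∑ₛ m (suc r) (λ R → f (false ∷ R))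
∑ₛ-suc m r f = trans (∑-vecs bools m (λ R → ⟦ size R ℕ.≡ᵇ suc r ⟧ * f R)) (cong (∑ₛ m r (λ R → f (true ∷ R)) +_) (+-identityʳ _))

-- Finite differences

∇-cong : ∀ r {f g} → (∀ x → f x ≡ g x) → ∀ x → ∇ r f x ≡ ∇ r g x
∇-cong zero    eq x = eq x
∇-cong (suc r) eq x = cong₂ _-_ (∇-cong r eq x) (∇-cong r eq (x - 1ℚ))

∇-− : ∀ r f g x → ∇ r (λ x → f x - g x) x ≡ ∇ r f x - ∇ r g x
∇-− zero    f g x = refl
∇-− (suc r) f g x = trans (cong₂ _-_ (∇-− r f g x) (∇-− r f g (x - 1ℚ))) (interchange (∇ r f x) (∇ r g x) (∇ r f (x - 1ℚ)) (∇ r g (x - 1ℚ)))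
  where
  interchange : ∀ a b c d → a - b - (c - d) ≡ a - c - (b - d)
  interchange = solve-∀ ringℚ

∇-1 : ∀ r x → ∇ (suc r) (λ _ → 1ℚ) x ≡ 0ℚ
∇-1 zero    x = refl
∇-1 (suc r) x = cong₂ _-_ (∇-1 r x) (∇-1 r (x - 1ℚ))

-- Only two terms occur because second differences of x vanish. The linear factor is taken at the
-- far node x - (r+1), which in `scan-suc` is the value z + j of the vertex being scanned.
∇-leibniz : ∀ r f x → ∇ (suc r) (λ x → x * f x) x ≡ (x - fromℕ (suc r)) * ∇ (suc r) f x + fromℕ (suc r) * ∇ r f x
∇-leibniz zero    f x = base x (f x) (f (x - 1ℚ))
  where
  base : ∀ x a b → x * a - (x - 1ℚ) * b ≡ (x - 1ℚ) * (a - b) + 1ℚ * a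
  base = solve-∀ ringℚ
∇-leibniz (suc r) f x = begin
  ∇ (suc r) (λ x → x * f x) x - ∇ (suc r) (λ x → x * f x) (x - 1ℚ)
    ≡⟨ cong₂ _-_ (∇-leibniz r f x) (∇-leibniz r f (x - 1ℚ)) ⟩
  (x - c) * (a - b) + c * a - ((x - 1ℚ - c) * (b - d) + c * b)
    ≡⟨ rearrange x c a b d ⟩
  (x - (1ℚ + c)) * (a - b - (b - d)) + (1ℚ + c) * (a - b)
    ≡⟨ cong (λ t → (x - t) * (a - b - (b - d)) + t * (a - b)) (sym (fromℕ-suc (suc r))) ⟩
  (x - fromℕ (suc (suc r))) * (a - b - (b - d)) + fromℕ (suc (suc r)) * (a - b) ∎
  where
  a b c d : ℚ
  a = ∇ r f x
  b = ∇ r f (x - 1ℚ)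
  c = fromℕ (suc r)
  d = ∇ r f (x - 1ℚ - 1ℚ)
  rearrange : ∀ x c a b d → (x - c) * (a - b) + c * a - ((x - 1ℚ - c) * (b - d) + c * b)
            ≡ (x - (1ℚ + c)) * (a - b - (b - d)) + (1ℚ + c) * (a - b)
  rearrange = solve-∀ ringℚ

κ-∑ₛ : ∀ m r (f : Vec Bool m → ℚ) → ∑ₛ m r (λ R → κ (size R) * f R) ≡ κ r * ∑ₛ m r f
κ-∑ₛ m r f = trans (∑ₛ-cong m r (λ R size≡ → cong (λ t → κ t * f R) size≡)) (∑ₛ-*ˡ m r (κ r) f)

φ-suc : ∀ m x → x * φ m x - x ↑ m ≡ φ (suc m) x
φ-suc m x = rearrange x (x ↑ m) (dpow m x)
  where
  rearrange : ∀ x p d → x * (p - d) - p ≡ x * p - (x * d + p)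
  rearrange = solve-∀ ringℚ

-- Summation over the subsets R

module _ (z : ℚ) where

  private
    -- The largest value available to a vertex outside R when j elements of R have been passed and r
    -- are still to come.
    at : ℕ → ℕ → ℚ
    at r j = z + fromℕ j + fromℕ r

  scan-zero : ∀ (f : ℚ → ℚ) j {b} → κ 0 * b ≡ f (at 0 j) → κ 0 * ((z + fromℕ j) * b) ≡ at 0 j * f (at 0 j)
  scan-zero f j {b} eq = trans (rearrange z (fromℕ j) b) (cong (at 0 j *_) eq)
    where
    rearrange : ∀ z j b → 1ℚ * ((z + j) * b) ≡ (z + j + 0ℚ) * (1ℚ * b)
    rearrange = solve-∀ ringℚ

  -- The next vertex is either in R, with `κ r` parents and j raised by one, or outside, with z + j
  -- parents. Since `at r (suc j)` equals `at (suc r) j`, both induction hypotheses are differences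
  -- at the same point and the Leibniz rule combines them.
  scan-suc : ∀ f r j {a b} → κ r * a ≡ ∇ r f (at r (suc j)) → κ (suc r) * b ≡ ∇ (suc r) f (at (suc r) j) →
             κ (suc r) * (κ r * a + (z + fromℕ j) * b) ≡ ∇ (suc r) (λ x → x * f x) (at (suc r) j)
  scan-suc f r j {a} {b} eqa eqb = begin
    κ (suc r) * (κ r * a + (z + fromℕ j) * b)
      ≡⟨ rearrange (fromℕ (suc r)) (κ r * a) z (fromℕ j) b ⟩
    (at (suc r) j - fromℕ (suc r)) * (κ (suc r) * b) + fromℕ (suc r) * (κ r * a)
      ≡⟨ cong₂ (λ s t → (at (suc r) j - fromℕ (suc r)) * s + fromℕ (suc r) * t) eqb (trans eqa (cong (∇ r f) at-shift)) ⟩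
    (at (suc r) j - fromℕ (suc r)) * ∇ (suc r) f (at (suc r) j) + fromℕ (suc r) * ∇ r f (at (suc r) j)
      ≡⟨ sym (∇-leibniz r f (at (suc r) j)) ⟩
    ∇ (suc r) (λ x → x * f x) (at (suc r) j) ∎
    where
    rearrange : ∀ s a z j b → s * (a + (z + j) * b) ≡ (z + j + s - s) * (s * b) + s * a
    rearrange = solve-∀ ringℚ
    reorder : ∀ z j r → z + (1ℚ + j) + r ≡ z + j + (1ℚ + r)
    reorder = solve-∀ ringℚ
    at-shift : at r (suc j) ≡ at (suc r) j
    at-shift = trans (cong (λ t → z + t + fromℕ r) (fromℕ-suc j)) (trans (reorder z (fromℕ j) (fromℕ r)) (cong (z + fromℕ j +_) (sym (fromℕ-suc r))))

  -- Apart from the factorial contributed by R, the sum is the complete homogeneous polynomial of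
  -- degree m - r in z+j, ..., z+j+r, that is, a divided difference of the m-th power; `κ r` turns
  -- the factorial into r!.
  ∑ₛ-∏ : ∀ m r j → κ r * ∑ₛ m r (λ R → ∏ (choices z j R)) ≡ ∇ r (_↑ m) (at r j)
  ∑ₛ-∏ zero    zero    j = refl
  ∑ₛ-∏ zero    (suc r) j = trans (*-zeroʳ (κ (suc r))) (sym (∇-1 r (at (suc r) j)))
  ∑ₛ-∏ (suc m) zero    j = begin
    κ 0 * ∑ₛ (suc m) 0 (λ R → ∏ (choices z j R))
      ≡⟨ cong (κ 0 *_) (trans (∑ₛ-zero m _) (∑ₛ-*ˡ m 0 (z + fromℕ j) _)) ⟩
    κ 0 * ((z + fromℕ j) * ∑ₛ m 0 (λ R → ∏ (choices z j R)))
      ≡⟨ scan-zero (_↑ m) j (∑ₛ-∏ m 0 j) ⟩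
    ∇ 0 (_↑ suc m) (at 0 j) ∎
  ∑ₛ-∏ (suc m) (suc r) j = begin
    κ (suc r) * ∑ₛ (suc m) (suc r) (λ R → ∏ (choices z j R))
      ≡⟨ cong (κ (suc r) *_) (trans (∑ₛ-suc m r _) (cong₂ _+_ (κ-∑ₛ m r _) (∑ₛ-*ˡ m (suc r) (z + fromℕ j) _))) ⟩
    κ (suc r) * (κ r * ∑ₛ m r (λ R → ∏ (choices z (suc j) R)) + (z + fromℕ j) * ∑ₛ m (suc r) (λ R → ∏ (choices z j R)))
      ≡⟨ scan-suc (_↑ m) r j (∑ₛ-∏ m r (suc j)) (∑ₛ-∏ m (suc r) j) ⟩
    ∇ (suc r) (_↑ suc m) (at (suc r) j) ∎

  forestWeight-true : ∀ {m} j (R : Vec Bool m) → forestWeight z j (true ∷ R) ≡ κ (size R) * forestWeight z (suc j) R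
  forestWeight-true j R = rearrange (κ (size R)) _ _
    where
    rearrange : ∀ k p d → k * p - (k * d + 0ℚ * p) ≡ k * (p - d)
    rearrange = solve-∀ ringℚ

  forestWeight-false : ∀ {m} j (R : Vec Bool m) → forestWeight z j (false ∷ R) ≡ (z + fromℕ j) * forestWeight z j R - ∏ (choices z j R)
  forestWeight-false j R = rearrange (z + fromℕ j) _ _
    where
    rearrange : ∀ k p d → k * p - (k * d + 1ℚ * p) ≡ k * (p - d) - p
    rearrange = solve-∀ ringℚ

  private
    false-sum : ∀ m r j → ∑ₛ m r (λ R → forestWeight z j (false ∷ R))
              ≡ (z + fromℕ j) * ∑ₛ m r (forestWeight z j) - ∑ₛ m r (λ R → ∏ (choices z j R))
    false-sum m r j = trans (∑ₛ-cong m r (λ R _ → forestWeight-false j R))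
      (trans (∑ₛ-− m r (λ R → (z + fromℕ j) * forestWeight z j R) _) (cong (_- ∑ₛ m r (λ R → ∏ (choices z j R))) (∑ₛ-*ˡ m r (z + fromℕ j) _)))

    ∇-φ-suc : ∀ m r x → ∇ r (λ x → x * φ m x) x - ∇ r (_↑ m) x ≡ ∇ r (φ (suc m)) x
    ∇-φ-suc m r x = trans (sym (∇-− r (λ x → x * φ m x) (_↑ m) x)) (∇-cong r (φ-suc m) x)

  -- A vertex outside R produces the additional term -∏, summed by `∑ₛ-∏`; the recurrence x φ_m -
  -- x^m = φ_(m+1) absorbs it.
  ∑ₛ-forestWeight : ∀ m r j → κ r * ∑ₛ m r (forestWeight z j) ≡ ∇ r (φ m) (at r j)
  ∑ₛ-forestWeight zero    zero    j = refl
  ∑ₛ-forestWeight zero    (suc r) j = trans (*-zeroʳ (κ (suc r))) (sym (∇-1 r (at (suc r) j)))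
  ∑ₛ-forestWeight (suc m) zero    j = begin
    κ 0 * ∑ₛ (suc m) 0 (forestWeight z j)
      ≡⟨ cong (κ 0 *_) (trans (∑ₛ-zero m (forestWeight z j)) (false-sum m 0 j)) ⟩
    κ 0 * ((z + fromℕ j) * ∑ₛ m 0 (forestWeight z j) - ∑ₛ m 0 (λ R → ∏ (choices z j R)))
      ≡⟨ *-distribˡ-− (κ 0) ((z + fromℕ j) * ∑ₛ m 0 (forestWeight z j)) (∑ₛ m 0 (λ R → ∏ (choices z j R))) ⟩
    κ 0 * ((z + fromℕ j) * ∑ₛ m 0 (forestWeight z j)) - κ 0 * ∑ₛ m 0 (λ R → ∏ (choices z j R))
      ≡⟨ cong₂ _-_ (scan-zero (φ m) j (∑ₛ-forestWeight m 0 j)) (∑ₛ-∏ m 0 j) ⟩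
    at 0 j * φ m (at 0 j) - at 0 j ↑ m
      ≡⟨ φ-suc m (at 0 j) ⟩
    ∇ 0 (φ (suc m)) (at 0 j) ∎
  ∑ₛ-forestWeight (suc m) (suc r) j = begin
    κ (suc r) * ∑ₛ (suc m) (suc r) (forestWeight z j)
      ≡⟨ cong (κ (suc r) *_) (trans (∑ₛ-suc m r (forestWeight z j))
           (cong₂ _+_ (trans (∑ₛ-cong m r (λ R _ → forestWeight-true j R)) (κ-∑ₛ m r (forestWeight z (suc j)))) (false-sum m (suc r) j))) ⟩
    κ (suc r) * (a + ((z + fromℕ j) * b - c))
      ≡⟨ regroup (κ (suc r)) a ((z + fromℕ j) * b) c ⟩
    κ (suc r) * (a + (z + fromℕ j) * b) - κ (suc r) * c
      ≡⟨ cong₂ _-_ (scan-suc (φ m) r j (∑ₛ-forestWeight m r (suc j)) (∑ₛ-forestWeight m (suc r) j)) (∑ₛ-∏ m (suc r) j) ⟩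
    ∇ (suc r) (λ x → x * φ m x) (at (suc r) j) - ∇ (suc r) (_↑ m) (at (suc r) j)
      ≡⟨ ∇-φ-suc m (suc r) (at (suc r) j) ⟩
    ∇ (suc r) (φ (suc m)) (at (suc r) j) ∎
    where
    a b c : ℚ
    a = κ r * ∑ₛ m r (forestWeight z (suc j))
    b = ∑ₛ m (suc r) (forestWeight z j)
    c = ∑ₛ m (suc r) (λ R → ∏ (choices z j R))
    regroup : ∀ k a b c → k * (a + (b - c)) ≡ k * (a + b) - k * c
    regroup = solve-∀ ringℚ

-- Iteration of the parent map

module _ {m} (f : Fin m → Fin m) where

  iter-+ : ∀ a b v → iter f (a ℕ.+ b) v ≡ iter f a (iter f b v)
  iter-+ zero    b v = refl
  iter-+ (suc a) b v = cong f (iter-+ a b v)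

  iter-shift : ∀ i v → iter f i (f v) ≡ f (iter f i v)
  iter-shift zero    v = refl
  iter-shift (suc i) v = cong f (iter-shift i v)

  iter-fixed : ∀ {v} → f v ≡ v → ∀ i → iter f i v ≡ v
  iter-fixed fv zero    = refl
  iter-fixed fv (suc i) = trans (cong f (iter-fixed fv i)) fv

  iter-periodic : ∀ {d v} → iter f d v ≡ v → ∀ e → iter f (e ℕ.* d) v ≡ v
  iter-periodic         per zero    = refl
  iter-periodic {d} {v} per (suc e) = trans (iter-+ d (e ℕ.* d) v) (trans (cong (iter f d) (iter-periodic per e)) per)

  iter-stays : ∀ {v w a b} → f w ≡ w → a ℕ.≤ b → iter f a v ≡ w → iter f b v ≡ w
  iter-stays {v} {w} {a} {b} fw a≤b eq = begin
    iter f b v                       ≡⟨ cong (λ c → iter f c v) (sym (ℕP.m∸n+n≡m a≤b)) ⟩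
    iter f (b ∸ a ℕ.+ a) v           ≡⟨ iter-+ (b ∸ a) a v ⟩
    iter f (b ∸ a) (iter f a v)      ≡⟨ cong (iter f (b ∸ a)) eq ⟩
    iter f (b ∸ a) w                 ≡⟨ iter-fixed fw (b ∸ a) ⟩
    w                                ∎

-- By pigeonhole two of the first n + 2 iterates agree, and a fixed point is the only
-- periodic point on an orbit that reaches it.
iter-settles : ∀ {n} (f : Fin (suc n) → Fin (suc n)) {w} → f w ≡ w → ∀ {v} e → iter f e v ≡ w → iter f n v ≡ w
iter-settles {n} f {w} fw {v} e reach with FP.pigeonhole (ℕP.n<1+n (suc n)) (λ (i : Fin (suc (suc n))) → iter f (toℕ i) v)
... | i , j , i<j , same = iter-stays f {a = toℕ i} fw (ℕP.≤-pred (ℕP.<-≤-trans i<j (ℕP.≤-pred (FP.toℕ<n j)))) u≡w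
  where
  u : Fin (suc n)
  u = iter f (toℕ i) v
  d : ℕ
  d = toℕ j ∸ toℕ i
  period : iter f d u ≡ u
  period = trans (sym (iter-+ f d (toℕ i) v)) (trans (cong (λ c → iter f c v) (ℕP.m∸n+n≡m (ℕP.<⇒≤ i<j))) (sym same))
  u-reaches : iter f e u ≡ w
  u-reaches = begin
    iter f e (iter f (toℕ i) v)      ≡⟨ sym (iter-+ f e (toℕ i) v) ⟩
    iter f (e ℕ.+ toℕ i) v           ≡⟨ iter-stays f {a = e} fw (ℕP.m≤m+n e (toℕ i)) reach ⟩
    w                                ∎
  -- The exponent e * d is a multiple of the period and, as d > 0, at least e; so the iterate of u
  -- is both u and w.
  u≡w : u ≡ w
  u≡w = trans (sym (iter-periodic f {d} period e))
              (iter-stays f {a = e} fw (ℕP.m≤m*n e d {{ℕ.>-nonZero (ℕP.m<n⇒0<n∸m i<j)}}) u-reaches)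

-- Trees versus local conditions with acyclicity

<ᵇ-true : ∀ {a b} → (a ℕ.<ᵇ b) ≡ true → a ℕ.< b
<ᵇ-true {a} {b} eq = ℕP.<ᵇ⇒< a b (subst T (sym eq) tt)

true-<ᵇ : ∀ {a b} → a ℕ.< b → (a ℕ.<ᵇ b) ≡ true
true-<ᵇ {a} {b} lt = Equivalence.to BP.T-≡ (ℕP.<⇒<ᵇ lt)

∧-true : ∀ {a b} → a ∧ b ≡ true → a ≡ true × b ≡ true
∧-true {true} eq = refl , eq

∨-true : ∀ {a b} → a ∨ b ≡ true → a ≡ true ⊎ b ≡ true
∨-true {true}  eq = inj₁ refl
∨-true {false} eq = inj₂ eq

≡ᵇ-true : ∀ a b → (a ℕ.≡ᵇ b) ≡ true → a ≡ b
≡ᵇ-true a b eq = ℕP.≡ᵇ⇒≡ a b (subst T (sym eq) tt)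

module _ {m} (R : Vec Bool m) (v u : Fin m) where

  local-inside : lookup R v ≡ true → local R v u ≡ true →
                 lookup R u ≡ true × (toℕ v ℕ.< toℕ u ⊎ (u ≡ v × above R v ≡ 0))
  local-inside Rv loc rewrite Rv with ∧-true {lookup R u} loc
  ... | Ru , rest with ∨-true {toℕ v ℕ.<ᵇ toℕ u} rest
  ...   | inj₁ lt   = Ru , inj₁ (<ᵇ-true lt)
  ...   | inj₂ rest′ with ∧-true {toℕ v ℕ.≡ᵇ toℕ u} rest′
  ...     | same , top = Ru , inj₂ (FP.toℕ-injective (sym (≡ᵇ-true (toℕ v) (toℕ u) same)) , ≡ᵇ-true (above R v) 0 top)

  local-outside : lookup R v ≡ false → local R v u ≡ true → lookup R u ≡ false ⊎ toℕ u ℕ.< toℕ v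
  local-outside Rv loc rewrite Rv with lookup R u
  ... | true  = inj₂ (<ᵇ-true loc)
  ... | false = inj₁ refl

  inside-local-< : lookup R v ≡ true → lookup R u ≡ true → toℕ v ℕ.< toℕ u → local R v u ≡ true
  inside-local-< Rv Ru v<u rewrite Rv | Ru | true-<ᵇ v<u = refl

  outside-local : lookup R v ≡ false → lookup R u ≡ false ⊎ toℕ u ℕ.< toℕ v → local R v u ≡ true
  outside-local Rv (inj₁ Ru)  rewrite Rv | Ru = refl
  outside-local Rv (inj₂ u<v) rewrite Rv | true-<ᵇ u<v = BP.∨-zeroʳ (not (lookup R u))

≡ᵇ-refl : ∀ a → (a ℕ.≡ᵇ a) ≡ true
≡ᵇ-refl zero    = refl
≡ᵇ-refl (suc a) = ≡ᵇ-refl a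

inside-local-top : ∀ {m} (R : Vec Bool m) v → lookup R v ≡ true → above R v ≡ 0 → local R v v ≡ true
inside-local-top R v Rv top rewrite Rv | top | ≡ᵇ-refl (toℕ v) = BP.∨-zeroʳ (toℕ v ℕ.<ᵇ toℕ v)

size-lookup : ∀ {m} (R : Vec Bool m) u → lookup R u ≡ true → size R ≢ 0
size-lookup (true ∷ R)  F.zero    Ru ()
size-lookup (true ∷ R)  (F.suc u) Ru ()
size-lookup (false ∷ R) (F.suc u) Ru = size-lookup R u Ru

above-lookup : ∀ {m} (R : Vec Bool m) v u → lookup R u ≡ true → toℕ v ℕ.< toℕ u → above R v ≢ 0
above-lookup (b ∷ R) F.zero    (F.suc u) Ru _         = size-lookup R u Ru
above-lookup (b ∷ R) (F.suc v) (F.suc u) Ru (s≤s v<u) = above-lookup R v u Ru v<u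

size-top : ∀ {m} (R : Vec Bool m) → size R ≢ 0 → ∃ λ u → lookup R u ≡ true × above R u ≡ 0
size-top []          ne = ⊥-elim (ne refl)
size-top (false ∷ R) ne with size-top R ne
... | u , Ru , top = F.suc u , Ru , top
size-top (true ∷ R)  ne with size R ℕ.≟ 0
... | yes eq = F.zero , refl , eq
... | no  R≢0 with size-top R R≢0
...   | u , Ru , top = F.suc u , Ru , top

above-top : ∀ {m} (R : Vec Bool m) v → above R v ≢ 0 → ∃ λ u → lookup R u ≡ true × toℕ v ℕ.< toℕ u
above-top (b ∷ R) F.zero    ne with size-top R ne
... | u , Ru , _ = F.suc u , Ru , s≤s z≤n
above-top (b ∷ R) (F.suc v) ne with above-top R v ne
... | u , Ru , v<u = F.suc u , Ru , s≤s v<u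

contract-inside : ∀ {m} (R : Vec Bool m) v u → lookup R v ≡ true → contract R v u ≡ nothing
contract-inside R v u Rv rewrite Rv = refl

contract-entering : ∀ {m} (R : Vec Bool m) v u → lookup R u ≡ true → contract R v u ≡ nothing
contract-entering R v u Ru rewrite Ru | BP.∨-zeroʳ (lookup R v) = refl

contract-outside : ∀ {m} (R : Vec Bool m) v u → lookup R v ≡ false → lookup R u ≡ false → contract R v u ≡ just u
contract-outside R v u Rv Ru rewrite Rv | Ru = refl

bool-cases : ∀ b → b ≡ true ⊎ b ≡ false
bool-cases true  = inj₁ refl
bool-cases false = inj₂ refl

true≢false : ∀ {b} → b ≡ true → b ≡ false → ⊥
true≢false refl ()

module _ {n} (p : ParentMap n) where

  private
    f : Fin (suc n) → Fin (suc n)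
    f = lookup p
    ρ : Fin (suc n)
    ρ = root p

  -- The bound i < n makes `InMD` decidable but is awkward under passing from v to its parent; the
  -- unbounded form is stable under that step.
  Ascends : Fin (suc n) → Set
  Ascends v = ∀ i → iter f i v ≢ ρ → toℕ (iter f i v) ℕ.< toℕ (f (iter f i v))

  InMD⇒Ascends : IsTree p → ∀ {v} → InMD p v → Ascends v
  InMD⇒Ascends (fρ , reach) {v} md i ≢ρ with i ℕP.<? n
  ... | yes i<n = subst (λ a → iter f a v ≢ ρ → toℕ (iter f a v) ℕ.< toℕ (f (iter f a v))) (FP.toℕ-fromℕ< i<n) (md (F.fromℕ< i<n)) ≢ρ
  ... | no  i≮n = ⊥-elim (≢ρ (iter-stays f {a = n} fρ (ℕP.≮⇒≥ i≮n) (reach v)))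

  Ascends⇒InMD : ∀ {v} → Ascends v → InMD p v
  Ascends⇒InMD asc i = asc (toℕ i)

  Ascends-parent : ∀ {v} → Ascends v → Ascends (f v)
  Ascends-parent {v} asc i rewrite iter-shift f i v = asc (suc i)

  Ascends-child : ∀ {v} → toℕ v ℕ.< toℕ (f v) → Ascends (f v) → Ascends v
  Ascends-child {v} v<fv asc zero    _ = v<fv
  Ascends-child {v} v<fv asc (suc i) with asc i
  ... | asc-i rewrite iter-shift f i v = asc-i

  Ascends-≤ : IsTree p → ∀ {v} → Ascends v → ∀ i → toℕ v ℕ.≤ toℕ (iter f i v)
  Ascends-≤ tree asc zero    = ℕP.≤-refl
  Ascends-≤ tree@(fρ , _) {v} asc (suc i) with iter f i v F.≟ ρ
  ... | yes eq = subst (λ w → toℕ v ℕ.≤ toℕ w) (sym (trans (cong f eq) (trans fρ (sym eq)))) (Ascends-≤ tree asc i)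
  ... | no  ≢ρ = ℕP.≤-trans (Ascends-≤ tree asc i) (ℕP.<⇒≤ (asc i ≢ρ))

  Ascends-root : f ρ ≡ ρ → Ascends ρ
  Ascends-root fρ i ≢ρ = ⊥-elim (≢ρ (iter-fixed f fρ i))

  module _ (R : Vec Bool (suc n)) where

    private
      q : Vec (Maybe (Fin (suc n))) (suc n)
      q = mapᵢ (contract R) p
      lookup-q : ∀ v → lookup q v ≡ contract R v (f v)
      lookup-q = lookup-mapᵢ (contract R) p

    -- The path towards ρ is followed until its first edge that touches R, which `contract` sends to
    -- the sink.
    Sinks-R : ∀ {ρ} → lookup R ρ ≡ true → ∀ i v → iter f i v ≡ ρ → Sinks q (just v)
    Sinks-R Rρ zero    v refl = step (subst (Sinks q) (sym (trans (lookup-q v) (contract-inside R v (f v) Rρ))) sink)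
    Sinks-R Rρ (suc i) v eq with bool-cases (lookup R v) | bool-cases (lookup R (f v))
    ... | inj₁ Rv | _        = step (subst (Sinks q) (sym (trans (lookup-q v) (contract-inside R v (f v) Rv))) sink)
    ... | inj₂ _  | inj₁ Rfv = step (subst (Sinks q) (sym (trans (lookup-q v) (contract-entering R v (f v) Rfv))) sink)
    ... | inj₂ Rv | inj₂ Rfv = step (subst (Sinks q) (sym (trans (lookup-q v) (contract-outside R v (f v) Rv Rfv))) (Sinks-R Rρ i (f v) (trans (iter-shift f i v) eq)))

    Sinks-reaches-R : ∀ {x} → Sinks q x → ∀ {v} → x ≡ just v → ∃ λ i → lookup R (iter f i v) ≡ true
    Sinks-reaches-R (step s) {v} refl with bool-cases (lookup R v) | bool-cases (lookup R (f v))
    ... | inj₁ Rv | _        = 0 , Rv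
    ... | inj₂ _  | inj₁ Rfv = 1 , Rfv
    ... | inj₂ Rv | inj₂ Rfv with Sinks-reaches-R s (trans (lookup-q v) (contract-outside R v (f v) Rv Rfv))
    ...   | i , Ri = suc i , subst (λ w → lookup R w ≡ true) (iter-shift f i v) Ri

    module FromTree (tree : IsTree p) (R⇒MD : ∀ v → lookup R v ≡ true → InMD p v) (MD⇒R : ∀ v → InMD p v → lookup R v ≡ true) where

      private
        fρ : f ρ ≡ ρ
        fρ = proj₁ tree
        R⇒Ascends : ∀ v → lookup R v ≡ true → Ascends v
        R⇒Ascends v Rv = InMD⇒Ascends tree (R⇒MD v Rv)
        Ascends⇒R : ∀ v → Ascends v → lookup R v ≡ true
        Ascends⇒R v asc = MD⇒R v (Ascends⇒InMD asc)

      -- Labels never decrease on the way from an element of R to the root, so no element of R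
      -- exceeds the root.
      above-root : above R ρ ≡ 0
      above-root with above R ρ ℕ.≟ 0
      ... | yes eq = eq
      ... | no  ne with above-top R ρ ne
      ...   | u , Ru , ρ<u = contradiction (subst (λ w → toℕ u ℕ.≤ toℕ w) (proj₂ tree u) (Ascends-≤ tree (R⇒Ascends u Ru) n)) (ℕP.<⇒≱ ρ<u)

      tree-local : ∀ v → local R v (f v) ≡ true
      tree-local v with bool-cases (lookup R v)
      tree-local v | inj₁ Rv with v F.≟ ρ
      ... | no  v≢ρ = inside-local-< R v (f v) Rv (Ascends⇒R (f v) (Ascends-parent (R⇒Ascends v Rv))) (R⇒Ascends v Rv 0 v≢ρ)
      ... | yes v≡ρ = subst (λ w → local R w (f w) ≡ true) (sym v≡ρ)
                        (subst (λ w → local R ρ w ≡ true) (sym fρ) (inside-local-top R ρ (subst (λ w → lookup R w ≡ true) v≡ρ Rv) above-root))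
      tree-local v | inj₂ Rv with bool-cases (lookup R (f v))
      ... | inj₂ Rfv = outside-local R v (f v) Rv (inj₁ Rfv)
      -- If v were smaller than its parent in R, the ascending path would extend to v and put v into
      -- R; if v were its own parent, it would lie in R as well.
      ... | inj₁ Rfv with ℕP.<-cmp (toℕ v) (toℕ (f v))
      ...   | tri> _ _ fv<v = outside-local R v (f v) Rv (inj₂ fv<v)
      ...   | tri< v<fv _ _ = ⊥-elim (true≢false (Ascends⇒R v (Ascends-child v<fv (R⇒Ascends (f v) Rfv))) Rv)
      ...   | tri≈ _ v≡fv _ = ⊥-elim (true≢false (subst (λ w → lookup R w ≡ true) (sym (FP.toℕ-injective v≡fv)) Rfv) Rv)

      tree-acyclic : acyclic q ≡ true
      tree-acyclic = Sinks⇒acyclic q sinks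
        where
        sinks : ∀ x → Sinks q x
        sinks nothing  = sink
        sinks (just v) = Sinks-R (Ascends⇒R ρ (Ascends-root fρ)) n v (proj₂ tree v)

    module ToTree (R≢∅ : size R ≢ 0) (loc : ∀ v → local R v (f v) ≡ true) (ac : acyclic q ≡ true) where

      private
        -- The largest element of R; it will turn out to be the root.
        μ : Fin (suc n)
        μ = proj₁ (size-top R R≢∅)
        Rμ : lookup R μ ≡ true
        Rμ = proj₁ (proj₂ (size-top R R≢∅))
        top : above R μ ≡ 0
        top = proj₂ (proj₂ (size-top R R≢∅))

      top-unique : ∀ {v} → lookup R v ≡ true → above R v ≡ 0 → v ≡ μ
      top-unique {v} Rv topv with ℕP.<-cmp (toℕ v) (toℕ μ)
      ... | tri< v<μ _ _ = contradiction topv (above-lookup R v μ Rμ v<μ)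
      ... | tri≈ _ v≡μ _ = FP.toℕ-injective v≡μ
      ... | tri> _ _ μ<v = contradiction top (above-lookup R μ v Rv μ<v)

      parent-of-R : ∀ {v} → lookup R v ≡ true → lookup R (f v) ≡ true × (toℕ v ℕ.< toℕ (f v) ⊎ (f v ≡ v × v ≡ μ))
      parent-of-R {v} Rv with local-inside R v (f v) Rv (loc v)
      ... | Rfv , inj₁ v<fv          = Rfv , inj₁ v<fv
      ... | Rfv , inj₂ (fv≡v , topv) = Rfv , inj₂ (fv≡v , top-unique Rv topv)

      fμ : f μ ≡ μ
      fμ with parent-of-R Rμ
      ... | Rfμ , inj₁ μ<fμ       = contradiction top (above-lookup R μ (f μ) Rfμ μ<fμ)
      ... | Rfμ , inj₂ (fμ≡μ , _) = fμ≡μ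

      R-iter : ∀ {v} → lookup R v ≡ true → ∀ i → lookup R (iter f i v) ≡ true
      R-iter Rv zero    = Rv
      R-iter Rv (suc i) = proj₁ (parent-of-R (R-iter Rv i))

      -- Inside R labels strictly increase until μ is reached, and none exceeds n; d bounds the
      -- number of increases still possible.
      R-reaches-top : ∀ d v → suc n ℕ.≤ d ℕ.+ toℕ v → lookup R v ≡ true → ∃ λ i → iter f i v ≡ μ
      R-reaches-top zero    v bound Rv = contradiction (FP.toℕ<n v) (ℕP.≤⇒≯ bound)
      R-reaches-top (suc d) v bound Rv with parent-of-R Rv
      ... | Rfv , inj₂ (_ , v≡μ) = 0 , v≡μ
      ... | Rfv , inj₁ v<fv with R-reaches-top d (f v) (ℕP.≤-trans bound (ℕP.≤-trans (ℕP.≤-reflexive (sym (ℕP.+-suc d (toℕ v)))) (ℕP.+-monoʳ-≤ d v<fv))) Rfv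
      ...   | i , eq = suc i , trans (sym (iter-shift f i v)) eq

      reaches-R : ∀ v → ∃ λ i → lookup R (iter f i v) ≡ true
      reaches-R v = Sinks-reaches-R (acyclic⇒Sinks q ac (just v)) refl

      -- Acyclicity leads from v into R and the increase of labels leads on to μ. The length j + i
      -- of this path is not controlled, and `iter-settles` replaces it by the n steps that `IsTree`
      -- demands.
      reaches-top : ∀ v → iter f n v ≡ μ
      reaches-top v with reaches-R v
      ... | i , Ri with R-reaches-top (suc n) (iter f i v) (ℕP.m≤m+n (suc n) _) Ri
      ...   | j , eq = iter-settles f fμ (j ℕ.+ i) (trans (iter-+ f j i v) eq)

      ρ≡μ : ρ ≡ μ
      ρ≡μ = reaches-top F.zero

      isTree : IsTree p
      isTree = subst (λ r → f r ≡ r) (sym ρ≡μ) fμ , λ v → trans (reaches-top v) (sym ρ≡μ)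

      R⇒InMD : ∀ v → lookup R v ≡ true → InMD p v
      R⇒InMD v Rv = Ascends⇒InMD ascends
        where
        ascends : Ascends v
        ascends i ≢ρ with parent-of-R (R-iter Rv i)
        ... | _ , inj₁ lt        = lt
        ... | _ , inj₂ (_ , ≡μ)  = contradiction (trans ≡μ (sym ρ≡μ)) ≢ρ

      -- By induction along the path the parent of v lies in R. If v did not, the local condition
      -- would make that parent smaller than v, against the ascent; v is not the root because μ is
      -- in R.
      Ascends⇒R : ∀ i v → lookup R (iter f i v) ≡ true → Ascends v → lookup R v ≡ true
      Ascends⇒R zero    v Ri asc = Ri
      Ascends⇒R (suc i) v Ri asc with bool-cases (lookup R v)
      ... | inj₁ Rv = Rv
      ... | inj₂ Rv with local-outside R v (f v) Rv (loc v)
      ...   | inj₁ Rfv  = ⊥-elim (true≢false (Ascends⇒R i (f v) (subst (λ w → lookup R w ≡ true) (sym (iter-shift f i v)) Ri) (Ascends-parent asc)) Rfv)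
      ...   | inj₂ fv<v = ⊥-elim (ℕP.<-asym fv<v (asc 0 (λ v≡ρ → true≢false (subst (λ w → lookup R w ≡ true) (sym (trans v≡ρ ρ≡μ)) Rμ) Rv)))

      InMD⇒R : ∀ v → InMD p v → lookup R v ≡ true
      InMD⇒R v md = Ascends⇒R (proj₁ (reaches-R v)) v (proj₂ (reaches-R v)) (InMD⇒Ascends isTree md)

-- Counting trees by their maximal decreasing subtree

everywhere : ∀ {m} → (Fin m → A → Bool) → Vec A m → Bool
everywhere b []       = true
everywhere b (x ∷ xs) = b F.zero x ∧ everywhere (b ∘ F.suc) xs

weight-⟦⟧ : ∀ {m} (b : Fin m → A → Bool) xs → weight (λ v u → ⟦ b v u ⟧) xs ≡ ⟦ everywhere b xs ⟧
weight-⟦⟧ b []       = refl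
weight-⟦⟧ b (x ∷ xs) = trans (cong (⟦ b F.zero x ⟧ *_) (weight-⟦⟧ (b ∘ F.suc) xs)) (sym (⟦⟧-∧ (b F.zero x) _))

everywhere-lookup : ∀ {m} (b : Fin m → A → Bool) xs → everywhere b xs ≡ true → ∀ v → b v (lookup xs v) ≡ true
everywhere-lookup b (x ∷ xs) all F.zero    = proj₁ (∧-true all)
everywhere-lookup b (x ∷ xs) all (F.suc v) = everywhere-lookup (b ∘ F.suc) xs (proj₂ (∧-true {b F.zero x} all)) v

lookup-everywhere : ∀ {m} (b : Fin m → A → Bool) xs → (∀ v → b v (lookup xs v) ≡ true) → everywhere b xs ≡ true
lookup-everywhere b []       all = refl
lookup-everywhere b (x ∷ xs) all = cong₂ _∧_ (all F.zero) (lookup-everywhere (b ∘ F.suc) xs (all ∘ F.suc))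

_==_ : ∀ {m} → Vec Bool m → Vec Bool m → Bool
[]          == []      = true
(true ∷ S)  == (b ∷ R) = b ∧ (S == R)
(false ∷ S) == (b ∷ R) = not b ∧ (S == R)

==-sound : ∀ {m} (S R : Vec Bool m) → (S == R) ≡ true → S ≡ R
==-sound []          []          _  = refl
==-sound (true ∷ S)  (true ∷ R)  eq = cong (true ∷_) (==-sound S R eq)
==-sound (false ∷ S) (false ∷ R) eq = cong (false ∷_) (==-sound S R eq)

==-refl : ∀ {m} (S : Vec Bool m) → (S == S) ≡ true
==-refl []          = refl
==-refl (true ∷ S)  = ==-refl S
==-refl (false ∷ S) = ==-refl S

∑-== : ∀ {m} (S : Vec Bool m) (f : Vec Bool m → ℚ) → ∑ (vecs bools m) (λ R → ⟦ S == R ⟧ * f R) ≡ f S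
∑-== []              f = trans (+-identityʳ _) (*-identityˡ (f []))
∑-== {suc m} (b ∷ S) f = trans (∑-vecs bools m (λ R → ⟦ (b ∷ S) == R ⟧ * f R)) (by-head b)
  where
  vanish : ∀ c → ∑ (vecs bools m) (λ R → 0ℚ * f (c ∷ R)) ≡ 0ℚ
  vanish c = trans (∑-cong (vecs bools m) (λ R → *-zeroˡ (f (c ∷ R)))) (∑-zero (vecs bools m))
  by-head : ∀ b → ∑ bools (λ c → ∑ (vecs bools m) (λ R → ⟦ (b ∷ S) == (c ∷ R) ⟧ * f (c ∷ R))) ≡ f (b ∷ S)
  by-head true  = trans (cong₂ (λ s t → s + (t + 0ℚ)) (∑-== S (λ R → f (true ∷ R))) (vanish false)) (+-identityʳ _)
  by-head false = trans (cong₂ (λ s t → s + (t + 0ℚ)) (vanish true) (∑-== S (λ R → f (false ∷ R)))) (trans (+-identityˡ _) (+-identityʳ _))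

does⇒ : {P : Set} (P? : Dec P) → does P? ≡ true → P
does⇒ (yes p) _ = p

true-ext : ∀ {a b} → (a ≡ true → b ≡ true) → (b ≡ true → a ≡ true) → a ≡ b
true-ext {true}  {b}     f g = sym (f refl)
true-ext {false} {true}  f g = g refl
true-ext {false} {false} f g = refl

mdSet : ∀ {n} → ParentMap n → Vec Bool (suc n)
mdSet p = V.tabulate (λ v → does (inMD? p v))

length-filter-tabulate : ∀ {P : A → Set} (P? : ∀ x → Dec (P x)) {m} (f : Fin m → A) →
                         L.length (L.filter P? (L.tabulate f)) ≡ size (V.tabulate (λ v → does (P? (f v))))
length-filter-tabulate P? {zero}  f = refl
length-filter-tabulate P? {suc m} f with does (P? (f F.zero))
... | true  = cong suc (length-filter-tabulate P? (f ∘ F.suc))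
... | false = length-filter-tabulate P? (f ∘ F.suc)

tree-indicator : ∀ {n} (p : ParentMap n) R → size R ≢ 0 →
  ⟦ does (isTree? p) ⟧ * ⟦ mdSet p == R ⟧ ≡ weight (λ v u → ⟦ local R v u ⟧) p * ⟦ acyclic (mapᵢ (contract R) p) ⟧
tree-indicator {n} p R R≢∅ = begin
  ⟦ does (isTree? p) ⟧ * ⟦ mdSet p == R ⟧
    ≡⟨ sym (⟦⟧-∧ (does (isTree? p)) _) ⟩
  ⟦ does (isTree? p) ∧ (mdSet p == R) ⟧
    ≡⟨ cong ⟦_⟧ (true-ext from to) ⟩
  ⟦ everywhere (local R) p ∧ acyclic (mapᵢ (contract R) p) ⟧
    ≡⟨ ⟦⟧-∧ (everywhere (local R) p) _ ⟩
  ⟦ everywhere (local R) p ⟧ * ⟦ acyclic (mapᵢ (contract R) p) ⟧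
    ≡⟨ cong (_* ⟦ acyclic (mapᵢ (contract R) p) ⟧) (sym (weight-⟦⟧ (local R) p)) ⟩
  weight (λ v u → ⟦ local R v u ⟧) p * ⟦ acyclic (mapᵢ (contract R) p) ⟧ ∎
  where
  lookup-mdSet : ∀ v → lookup (mdSet p) v ≡ does (inMD? p v)
  lookup-mdSet v = VP.lookup∘tabulate (λ v → does (inMD? p v)) v
  from : does (isTree? p) ∧ (mdSet p == R) ≡ true → everywhere (local R) p ∧ acyclic (mapᵢ (contract R) p) ≡ true
  from eq with ∧-true {does (isTree? p)} eq
  ... | tree , same = cong₂ _∧_ (lookup-everywhere (local R) p tree-local) tree-acyclic
    where
    member : ∀ v → lookup R v ≡ does (inMD? p v)
    member v = trans (cong (λ S → lookup S v) (sym (==-sound (mdSet p) R same))) (lookup-mdSet v)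
    open FromTree p R (does⇒ (isTree? p) tree)
      (λ v Rv → does⇒ (inMD? p v) (trans (sym (member v)) Rv))
      (λ v md → trans (member v) (dec-true (inMD? p v) md))
  to : everywhere (local R) p ∧ acyclic (mapᵢ (contract R) p) ≡ true → does (isTree? p) ∧ (mdSet p == R) ≡ true
  to eq with ∧-true {everywhere (local R) p} eq
  ... | loc , ac = cong₂ _∧_ (dec-true (isTree? p) isTree) (trans (cong (_== R) mdSet≡R) (==-refl R))
    where
    open ToTree p R R≢∅ (everywhere-lookup (local R) p loc) ac
    member : ∀ v → does (inMD? p v) ≡ lookup R v
    member v = true-ext (λ md → InMD⇒R v (does⇒ (inMD? p v) md)) (λ Rv → dec-true (inMD? p v) (R⇒InMD v Rv))
    mdSet≡R : mdSet p ≡ R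
    mdSet≡R = trans (VP.tabulate-cong member) (VP.tabulate∘lookup R)

countT-∑ₛ : ∀ n k → fromℕ (countT n k) ≡ ∑ₛ (suc n) (suc k) (forestWeight (fromℕ (suc n) - fromℕ (suc k)) 0)
countT-∑ₛ n k = begin
  fromℕ (countT n k)
    ≡⟨ count-∑ (λ p → isTree? p ×-dec (mdSize p ℕ.≟ suc k)) P ⟩
  ∑ P (λ p → ⟦ does (isTree? p) ∧ (mdSize p ℕ.≡ᵇ suc k) ⟧)
    ≡⟨ ∑-cong P (λ p → trans (⟦⟧-∧ (does (isTree? p)) _) (cong (λ s → ⟦ does (isTree? p) ⟧ * ⟦ s ℕ.≡ᵇ suc k ⟧) (length-filter-tabulate (inMD? p) id))) ⟩
  ∑ P (λ p → ⟦ does (isTree? p) ⟧ * ⟦ size (mdSet p) ℕ.≡ᵇ suc k ⟧)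
    -- The trees are sorted by their maximal decreasing subtree: exactly one R equals `mdSet p`, so
    -- summing its indicator over R changes nothing.
    ≡⟨ ∑-cong P (λ p → sym (∑-== (mdSet p) (λ R → ⟦ does (isTree? p) ⟧ * ⟦ size R ℕ.≡ᵇ suc k ⟧))) ⟩
  ∑ P (λ p → ∑ (vecs bools (suc n)) (λ R → ⟦ mdSet p == R ⟧ * (⟦ does (isTree? p) ⟧ * ⟦ size R ℕ.≡ᵇ suc k ⟧)))
    ≡⟨ ∑-swap P (vecs bools (suc n)) _ ⟩
  ∑ (vecs bools (suc n)) (λ R → ∑ P (λ p → ⟦ mdSet p == R ⟧ * (⟦ does (isTree? p) ⟧ * ⟦ size R ℕ.≡ᵇ suc k ⟧)))
    ≡⟨ ∑-cong (vecs bools (suc n)) (λ R → trans (∑-cong P (λ p → rearrange ⟦ mdSet p == R ⟧ ⟦ does (isTree? p) ⟧ ⟦ size R ℕ.≡ᵇ suc k ⟧)) (∑-*ˡ P ⟦ size R ℕ.≡ᵇ suc k ⟧ _)) ⟩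
  ∑ₛ (suc n) (suc k) (λ R → ∑ P (λ p → ⟦ does (isTree? p) ⟧ * ⟦ mdSet p == R ⟧))
    ≡⟨ ∑ₛ-cong (suc n) (suc k) by-set ⟩
  ∑ₛ (suc n) (suc k) (forestWeight (fromℕ (suc n) - fromℕ (suc k)) 0) ∎
  where
  P : List (ParentMap n)
  P = allParentMaps n
  rearrange : ∀ a b c → a * (b * c) ≡ c * (b * a)
  rearrange = solve-∀ ringℚ
  by-set : ∀ R → size R ≡ suc k → ∑ P (λ p → ⟦ does (isTree? p) ⟧ * ⟦ mdSet p == R ⟧) ≡ forestWeight (fromℕ (suc n) - fromℕ (suc k)) 0 R
  by-set R size≡ = begin
    ∑ P (λ p → ⟦ does (isTree? p) ⟧ * ⟦ mdSet p == R ⟧)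
      ≡⟨ ∑-cong P (λ p → tree-indicator p R (λ size≡0 → ℕP.1+n≢0 (trans (sym size≡) size≡0))) ⟩
    ∑ P (λ p → weight (λ v u → ⟦ local R v u ⟧) p * ⟦ acyclic (mapᵢ (contract R) p) ⟧)
      ≡⟨ ∑-local-acyclic R ⟩
    forestWeight (fromℕ (suc n) - fromℕ (size R)) 0 R
      ≡⟨ cong (λ r → forestWeight (fromℕ (suc n) - fromℕ r) 0 R) size≡ ⟩
    forestWeight (fromℕ (suc n) - fromℕ (suc k)) 0 R ∎

countT-powG : ∀ n k → fromℕ (suc k) * fromℕ (countT n k) ≡ fromℕ (suc n !) * powG (suc k) (suc n)
countT-powG n k = begin
  fromℕ (suc k) * fromℕ (countT n k)                                ≡⟨ cong (fromℕ (suc k) *_) (countT-∑ₛ n k) ⟩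
  fromℕ (suc k) * ∑ₛ (suc n) (suc k) (forestWeight z 0)             ≡⟨ ∑ₛ-forestWeight z (suc n) (suc k) 0 ⟩
  -- The scan ends at z + (k+1), where z = (n+1) - (k+1) vertices lie outside R. This is n+1, the
  -- point that a = 0 gives on the series side.
  ∇ (suc k) (φ (suc n)) (z + 0ℚ + fromℕ (suc k))                    ≡⟨ cong (∇ (suc k) (φ (suc n))) (cancel (fromℕ (suc n)) (fromℕ (suc k))) ⟩
  ∇ (suc k) (φ (suc n)) (fromℕ (suc n))                             ≡⟨ sym (powG-φ (suc k) (suc n)) ⟩
  fromℕ (suc n !) * powG (suc k) (suc n)                            ∎
  where
  z : ℚ
  z = fromℕ (suc n) - fromℕ (suc k)
  cancel : ∀ a b → a - b + 0ℚ + b ≡ a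
  cancel = solve-∀ ringℚ

-- The series identities

-- G has no constant term, so each factor raises the x-order. This makes the truncated sums in
-- `expS` and `negLog1m` exact and matches the zeros of `inRange` for k > n.
powG-order : ∀ {j i} → i ℕ.< j → powG j i ≡ 0ℚ
powG-order {suc j} {i} (s≤s i≤j) = Σ≤-zero i term
  where
  term : ∀ a → a ℕ.≤ i → egf-G a * powG j (i ∸ a) ≡ 0ℚ
  term zero    _   = *-zeroˡ (powG j i)
  term (suc a) a<i = trans (cong (egf-G (suc a) *_) (powG-order (ℕP.<-≤-trans (ℕP.∸-monoʳ-< {i} {suc a} {0} (s≤s z≤n) a<i) i≤j))) (*-zeroʳ (egf-G (suc a)))

tG-* : ∀ H i j → (tG *S H) i (suc j) ≡ Σ≤ i (λ a → egf-G a * H (i ∸ a) j)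
tG-* H i j = Σ≤-cong i (λ a _ → begin
  Σ≤ (suc j) (λ b → tG a b * H (i ∸ a) (suc j ∸ b))         ≡⟨ Σ≤-head j (λ b → tG a b * H (i ∸ a) (suc j ∸ b)) ⟩
  0ℚ * H (i ∸ a) (suc j) + Σ≤ j (λ b → G a b * H (i ∸ a) (j ∸ b))
                                                            ≡⟨ cong₂ _+_ (*-zeroˡ (H (i ∸ a) (suc j))) (Σ≤-first j (λ b → trans (cong (_* H (i ∸ a) (j ∸ suc b)) (G-suc a b)) (*-zeroˡ (H (i ∸ a) (j ∸ suc b))))) ⟩
  0ℚ + egf-G a * H (i ∸ a) j                                ≡⟨ +-identityˡ _ ⟩
  egf-G a * H (i ∸ a) j                                     ∎)
  where
  G-suc : ∀ a b → G a (suc b) ≡ 0ℚ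
  G-suc zero    b = refl
  G-suc (suc a) b = refl

tG-*-zero : ∀ H i → (tG *S H) i zero ≡ 0ℚ
tG-*-zero H i = Σ≤-zero i (λ a _ → *-zeroˡ (H (i ∸ a) 0))

-- Since (tG)^m = t^m G^m, a coefficient at t^j involves a single power of tG, which `Σ≤-select`
-- extracts from the series for exp and ln.
powS-tG : ∀ m i j → powS tG m i j ≡ ⟦ m ℕ.≡ᵇ j ⟧ * powG m i
powS-tG zero    zero    zero    = refl
powS-tG zero    zero    (suc j) = refl
powS-tG zero    (suc i) zero    = refl
powS-tG zero    (suc i) (suc j) = refl
powS-tG (suc m) i       zero    = trans (tG-*-zero (powS tG m) i) (sym (*-zeroˡ (powG (suc m) i)))
powS-tG (suc m) i       (suc j) = begin
  (tG *S powS tG m) i (suc j)                                     ≡⟨ tG-* (powS tG m) i j ⟩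
  Σ≤ i (λ a → egf-G a * powS tG m (i ∸ a) j)                      ≡⟨ Σ≤-cong i (λ a _ → trans (cong (egf-G a *_) (powS-tG m (i ∸ a) j)) (*-swap (egf-G a) ⟦ m ℕ.≡ᵇ j ⟧ (powG m (i ∸ a)))) ⟩
  Σ≤ i (λ a → ⟦ m ℕ.≡ᵇ j ⟧ * (egf-G a * powG m (i ∸ a)))          ≡⟨ Σ≤-*ˡ i ⟦ m ℕ.≡ᵇ j ⟧ _ ⟩
  ⟦ m ℕ.≡ᵇ j ⟧ * powG (suc m) i                                   ∎

Σ≤-select : ∀ n j (f : ℕ → ℚ) → (n ℕ.< j → f j ≡ 0ℚ) → Σ≤ n (λ m → ⟦ m ℕ.≡ᵇ j ⟧ * f m) ≡ f j
Σ≤-select n       zero    f _  = trans (Σ≤-first n (λ m → *-zeroˡ (f (suc m)))) (*-identityˡ (f 0))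
Σ≤-select zero    (suc j) f f≡0 = trans (*-zeroˡ (f 0)) (sym (f≡0 (s≤s z≤n)))
Σ≤-select (suc n) (suc j) f f≡0 = begin
  Σ≤ (suc n) (λ m → ⟦ m ℕ.≡ᵇ suc j ⟧ * f m)                       ≡⟨ Σ≤-head n (λ m → ⟦ m ℕ.≡ᵇ suc j ⟧ * f m) ⟩
  0ℚ * f 0 + Σ≤ n (λ m → ⟦ m ℕ.≡ᵇ j ⟧ * f (suc m))                ≡⟨ cong₂ _+_ (*-zeroˡ (f 0)) (Σ≤-select n j (f ∘ suc) (λ n<j → f≡0 (s≤s n<j))) ⟩
  0ℚ + f (suc j)                                                  ≡⟨ +-identityˡ _ ⟩
  f (suc j)                                                       ∎

inRange-* : ∀ n k q c → inRange n k q * c ≡ inRange n k (q * c)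
inRange-* n k q c with k ℕP.≤? n
... | yes _ = refl
... | no  _ = *-zeroˡ c

inRange-elim : ∀ n k {q r} → (k ℕ.≤ n → q ≡ r) → (n ℕ.< k → r ≡ 0ℚ) → inRange n k q ≡ r
inRange-elim n k inside beyond with k ℕP.≤? n
... | yes k≤n = inside k≤n
... | no  k≰n = sym (beyond (ℕP.≰⇒> k≰n))

-- The geometric series 1/(1 - tG) has coefficient G^j at t^j. The other two identities reduce to
-- this one after division by j! or by j.
LHS₂-powG : ∀ i j → LHS₂ i j ≡ powG j i
LHS₂-powG zero    zero    = refl
LHS₂-powG zero    (suc k) = sym (powG-order {suc k} (s≤s z≤n))
LHS₂-powG (suc n) zero    = refl
LHS₂-powG (suc n) (suc k) = inRange-elim n k (λ _ → (begin
  fromℕ (countT n k) * fromℕ (suc k) * recip (suc n !)            ≡⟨ cong (_* recip (suc n !)) (trans (ℚP.*-comm (fromℕ (countT n k)) _) (countT-powG n k)) ⟩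
  fromℕ (suc n !) * powG (suc k) (suc n) * recip (suc n !)        ≡⟨ rearrange (fromℕ (suc n !)) _ (recip (suc n !)) ⟩
  recip (suc n !) * fromℕ (suc n !) * powG (suc k) (suc n)        ≡⟨ cong (_* powG (suc k) (suc n)) (recip-inverseˡ (suc n !) {{suc n ℕP.!≢0}}) ⟩
  1ℚ * powG (suc k) (suc n)                                       ≡⟨ *-identityˡ _ ⟩
  powG (suc k) (suc n)                                            ∎)) (λ n<k → powG-order {suc k} (s≤s n<k))
  where
  rearrange : ∀ a b c → a * b * c ≡ c * a * b
  rearrange = solve-∀ ringℚ

LHS₁-LHS₂ : ∀ i j → LHS₁ i j ≡ LHS₂ i j * recip (j !)
LHS₁-LHS₂ zero    zero    = refl
LHS₁-LHS₂ zero    (suc k) = sym (*-zeroˡ (recip (suc k !)))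
LHS₁-LHS₂ (suc n) zero    = refl
LHS₁-LHS₂ (suc n) (suc k) = sym (trans (inRange-* n k _ (recip (suc k !))) (cong (inRange n k) (begin
  c * fromℕ (suc k) * r * recip (suc k !)       ≡⟨ rearrange c (fromℕ (suc k)) r (recip (suc k !)) ⟩
  c * (fromℕ (suc k) * recip (suc k !)) * r     ≡⟨ cong (λ t → c * t * r) (recip-! k) ⟩
  c * recip (k !) * r                           ∎)))
  where
  c r : ℚ
  c = fromℕ (countT n k)
  r = recip (suc n !)
  rearrange : ∀ c k r s → c * k * r * s ≡ c * (k * s) * r
  rearrange = solve-∀ ringℚ

LHS₃-LHS₂ : ∀ i k → LHS₃ i (suc k) ≡ LHS₂ i (suc k) * recip (suc k)
LHS₃-LHS₂ zero    k = sym (*-zeroˡ (recip (suc k)))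
LHS₃-LHS₂ (suc n) k = sym (trans (inRange-* n k _ (recip (suc k))) (cong (inRange n k) (begin
  c * fromℕ (suc k) * r * recip (suc k)         ≡⟨ rearrange c (fromℕ (suc k)) r (recip (suc k)) ⟩
  recip (suc k) * fromℕ (suc k) * (c * r)       ≡⟨ cong (_* (c * r)) (recip-inverseˡ (suc k)) ⟩
  1ℚ * (c * r)                                  ≡⟨ *-identityˡ _ ⟩
  c * r                                         ∎)))
  where
  c r : ℚ
  c = fromℕ (countT n k)
  r = recip (suc n !)
  rearrange : ∀ c k r s → c * k * r * s ≡ s * k * (c * r)
  rearrange = solve-∀ ringℚ

identity₁ : ∀ i j → LHS₁ i j ≡ expS tG i j
identity₁ i j = begin
  LHS₁ i j                                                        ≡⟨ trans (LHS₁-LHS₂ i j) (cong (_* recip (j !)) (LHS₂-powG i j)) ⟩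
  powG j i * recip (j !)                                          ≡⟨ sym (Σ≤-select i j (λ m → powG m i * recip (m !)) (λ i<j → trans (cong (_* recip (j !)) (powG-order {j} i<j)) (*-zeroˡ (recip (j !))))) ⟩
  Σ≤ i (λ m → ⟦ m ℕ.≡ᵇ j ⟧ * (powG m i * recip (m !)))            ≡⟨ Σ≤-cong i (λ m _ → trans (sym (ℚP.*-assoc ⟦ m ℕ.≡ᵇ j ⟧ (powG m i) _)) (cong (_* recip (m !)) (sym (powS-tG m i j)))) ⟩
  expS tG i j                                                     ∎

identity₃ : ∀ i j → LHS₃ i j ≡ negLog1m tG i j
identity₃ i zero    = begin
  LHS₃ i 0                                                        ≡⟨ LHS₃-zero i ⟩
  0ℚ                                                              ≡⟨ sym (Σ≤-zero i (λ m _ → trans (cong (_* recip (suc m)) (tG-*-zero (powS tG m) i)) (*-zeroˡ (recip (suc m))))) ⟩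
  negLog1m tG i 0                                                 ∎
  where
  LHS₃-zero : ∀ i → LHS₃ i 0 ≡ 0ℚ
  LHS₃-zero zero    = refl
  LHS₃-zero (suc i) = refl
identity₃ i (suc k) = begin
  LHS₃ i (suc k)                                                  ≡⟨ trans (LHS₃-LHS₂ i k) (cong (_* recip (suc k)) (LHS₂-powG i (suc k))) ⟩
  powG (suc k) i * recip (suc k)                                  ≡⟨ sym (Σ≤-select i k (λ m → powG (suc m) i * recip (suc m)) (λ i<k → trans (cong (_* recip (suc k)) (powG-order {suc k} (ℕP.m<n⇒m<1+n i<k))) (*-zeroˡ (recip (suc k))))) ⟩
  Σ≤ i (λ m → ⟦ m ℕ.≡ᵇ k ⟧ * (powG (suc m) i * recip (suc m)))    ≡⟨ Σ≤-cong i (λ m _ → trans (sym (ℚP.*-assoc ⟦ m ℕ.≡ᵇ k ⟧ (powG (suc m) i) _)) (cong (_* recip (suc m)) (sym (powS-tG (suc m) i (suc k))))) ⟩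
  negLog1m tG i (suc k)                                           ∎

Σ≤-reverse : ∀ n f → Σ≤ n (λ i → f (n ∸ i)) ≡ Σ≤ n f
Σ≤-reverse zero    f = refl
Σ≤-reverse (suc n) f = begin
  Σ≤ (suc n) (λ i → f (suc n ∸ i))           ≡⟨ Σ≤-head n (λ i → f (suc n ∸ i)) ⟩
  f (suc n) + Σ≤ n (λ i → f (n ∸ i))         ≡⟨ cong (f (suc n) +_) (Σ≤-reverse n f) ⟩
  f (suc n) + Σ≤ n f                         ≡⟨ ℚP.+-comm (f (suc n)) _ ⟩
  Σ≤ (suc n) f                               ∎

-- Brings 1 - tG to the left, the side on which `tG-*` and `*S-distribʳ` act.
*S-comm : ∀ F H i j → (F *S H) i j ≡ (H *S F) i j
*S-comm F H i j = begin
  Σ≤ i (λ a → Σ≤ j (λ b → F a b * H (i ∸ a) (j ∸ b)))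
    ≡⟨ sym (Σ≤-reverse i (λ a → Σ≤ j (λ b → F a b * H (i ∸ a) (j ∸ b)))) ⟩
  Σ≤ i (λ a → Σ≤ j (λ b → F (i ∸ a) b * H (i ∸ (i ∸ a)) (j ∸ b)))
    ≡⟨ Σ≤-cong i (λ a a≤i → trans (sym (Σ≤-reverse j (λ b → F (i ∸ a) b * H (i ∸ (i ∸ a)) (j ∸ b)))) (Σ≤-cong j (λ b b≤j →
         trans (ℚP.*-comm (F (i ∸ a) (j ∸ b)) _) (cong₂ (λ c d → H c d * F (i ∸ a) (j ∸ b)) (ℕP.m∸[m∸n]≡n a≤i) (ℕP.m∸[m∸n]≡n b≤j))))) ⟩
  Σ≤ i (λ a → Σ≤ j (λ b → H a b * F (i ∸ a) (j ∸ b))) ∎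

oneS-* : ∀ H i j → (oneS *S H) i j ≡ H i j
oneS-* H i j = begin
  (oneS *S H) i j                                  ≡⟨ Σ≤-first i (λ a → Σ≤-zero j (λ b _ → *-zeroˡ (H (i ∸ suc a) (j ∸ b)))) ⟩
  Σ≤ j (λ b → oneS 0 b * H i (j ∸ b))              ≡⟨ Σ≤-first j (λ b → *-zeroˡ (H i (j ∸ suc b))) ⟩
  1ℚ * H i j                                       ≡⟨ *-identityˡ (H i j) ⟩
  H i j                                            ∎

*S-distribʳ : ∀ E F H i j → ((E -S F) *S H) i j ≡ (E *S H) i j - (F *S H) i j
*S-distribʳ E F H i j = trans
  (Σ≤-cong i (λ a _ → trans (Σ≤-cong j (λ b _ → distrib (E a b) (F a b) (H (i ∸ a) (j ∸ b)))) (Σ≤-− j (λ b → E a b * H (i ∸ a) (j ∸ b)) _)))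
  (Σ≤-− i (λ a → Σ≤ j (λ b → E a b * H (i ∸ a) (j ∸ b))) _)
  where
  distrib : ∀ e f h → (e - f) * h ≡ e * h - f * h
  distrib = solve-∀ ringℚ

identity₂ : ∀ i j → (LHS₂ *S (oneS -S tG)) i j ≡ oneS i j
identity₂ i j = begin
  (LHS₂ *S (oneS -S tG)) i j                       ≡⟨ *S-comm LHS₂ (oneS -S tG) i j ⟩
  ((oneS -S tG) *S LHS₂) i j                       ≡⟨ *S-distribʳ oneS tG LHS₂ i j ⟩
  (oneS *S LHS₂) i j - (tG *S LHS₂) i j            ≡⟨ cong (_- (tG *S LHS₂) i j) (trans (oneS-* LHS₂ i j) (LHS₂-powG i j)) ⟩
  powG j i - (tG *S LHS₂) i j                      ≡⟨ by-degree j ⟩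
  oneS i j                                         ∎
  where
  oneS-suc : ∀ i j → oneS i (suc j) ≡ 0ℚ
  oneS-suc zero    j = refl
  oneS-suc (suc i) j = refl
  by-degree : ∀ j → powG j i - (tG *S LHS₂) i j ≡ oneS i j
  by-degree zero    = trans (cong (λ t → oneS i 0 - t) (tG-*-zero LHS₂ i)) (+-identityʳ (oneS i 0))
  by-degree (suc j) = begin
    -- Convolving G with G^j is `powG (suc j) i` by definition, so the geometric series telescopes.
    powG (suc j) i - (tG *S LHS₂) i (suc j)                             ≡⟨ cong (λ t → powG (suc j) i - t) (trans (tG-* LHS₂ i j) (Σ≤-cong i (λ a _ → cong (egf-G a *_) (LHS₂-powG (i ∸ a) j)))) ⟩
    powG (suc j) i - powG (suc j) i                                     ≡⟨ ℚP.+-inverseʳ (powG (suc j) i) ⟩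
    0ℚ                                                                  ≡⟨ sym (oneS-suc i j) ⟩
    oneS i (suc j)                                                      ∎

theorem3p2 : (∀ i j → LHS₁ i j ≡ expS tG i j)
    × (∀ i j → (LHS₂ *S (oneS -S tG)) i j ≡ oneS i j)
    × (∀ i j → LHS₃ i j ≡ negLog1m tG i j)
theorem3p2 = identity₁ , identity₂ , identity₃
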